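{- Let $G$ be a cograph and $r \geq 2$. The following are equivalent: (1) $\Sigma_r(G)$ is vertex decomposable; (2) $\Sigma_r(G)$ is shellable; (3) $\Sigma_r(G)$ is Cohen–Macaulay (over a field $\mathbb K$); (4) $G$ is $r$-gap-free; (5) the clutter $\mathrm{Con}_r(G)$ is co-chordal.
   Context: Cographs are the graphs obtained from single-vertex graphs by finitely many disjoint unions and joins (the join $G_1*G_2$ adds all edges between $V(G_1)$ and $V(G_2)$). $\mathrm{Con}_r(G)$ is the $r$-uniform clutter on $V(G)$ whose circuits are the $r$-subsets $W$ with $G[W]$ connected; $\Sigma_r(G)$ is the simplicial complex generated by $V(G)\setminus W$ for such $W$. $G$ is $r$-gap-free if every induced matching of $\mathrm{Con}_r(G)$ (set of pairwise disjoint circuits $M$ such that the circuits contained in $\bigcup M$ are exactly those of $M$) has at most one element. For a $d$-uniform clutter $\mathcal H$: a clique is a vertex set all of whose $d$-subsets are circuits; $\mathcal N_{\mathcal H}[Z]=Z\cup\{x\notin Z: x\in\mathcal E\subseteq Z\cup\{x\}\text{ for some circuit }\mathcal E\}$; a $(d-1)$-subset $Z$ is a simplicial maximal subcircuit if $\mathcal N_{\mathcal H}[Z]$ is a clique; $\mathcal H\setminus_d Z$ keeps the circuits not containing $Z$; $\mathcal H$ is chordal if it has no circuits or has a simplicial maximal subcircuit $Z$ with $\mathcal H\setminus_d Z$ chordal; $\mathcal H$ is co-chordal if its complement (circuits = $d$-subsets not circuits of $\mathcal H$) is chordal. Vertex decomposable and shellable have their standard meanings (simplex/empty/void complex or a shedding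 vertex with vertex decomposable link and deletion; a facet order with each new facet meeting the previous ones in a pure codimension-one subcomplex). -}

module Defs where

open import Level using (Level; _⊔_)
open import Data.Bool using (Bool; true; false; if_then_else_)
open import Data.Nat as ℕ using (ℕ; zero; suc; _+_; _<_; _<ᵇ_)
open import Data.Fin using (Fin; toℕ; splitAt)
open import Data.Fin.Subset using (Subset; _∈_; _∉_; _⊆_; _∪_; _∩_; ⁅_⁆; ∣_∣; ⋃; Empty)
open import Data.Vec using (lookup; tabulate)
open import Data.List using (List; length; foldr; allFin; map)
open import Data.List.Relation.Unary.All using (All)
open import Data.List.Relation.Unary.AllPairs using (AllPairs)
open import Data.List.Relation.Unary.Unique.Propositional using (Unique)
open import Data.List.Membership.Propositional using () renaming (_∈_ to _∈ₗ_)
open import Data.Product using (Σ; ∃; ∃-syntax; _×_; _,_)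
open import Data.Sum using (_⊎_; inj₁; inj₂)
open import Function.Bundles using (_⤖_; Bijection; _⇔_)
open import Relation.Nullary using (¬_)
open import Relation.Binary.PropositionalEquality using (_≡_)
open import Algebra.Bundles using (CommutativeRing)

record Field (c ℓ : Level) : Set (Level.suc (c ⊔ ℓ)) where
  field
    commutativeRing : CommutativeRing c ℓ
  open CommutativeRing commutativeRing public
  field
    0≉1     : ¬ (0# ≈ 1#)
    inverse : ∀ x → ¬ (x ≈ 0#) → ∃[ y ] (x * y ≈ 1#)

record Graph (n : ℕ) : Set where
  field
    adj   : Fin n → Fin n → Bool
    sym   : ∀ i j → adj i j ≡ adj j i
    irref : ∀ i → adj i i ≡ false
open Graph public

K₁ : Graph 1
K₁ = record { adj = λ _ _ → false ; sym = λ _ _ → _≡_.refl ; irref = λ _ → _≡_.refl }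

-- adjacency of a disjoint union (b = false) or join (b = true)
combAdj : ∀ {m k} → Bool → Graph m → Graph k →
          (Fin m ⊎ Fin k) → (Fin m ⊎ Fin k) → Bool
combAdj b G H (inj₁ x) (inj₁ y) = adj G x y
combAdj b G H (inj₂ x) (inj₂ y) = adj H x y
combAdj b G H (inj₁ x) (inj₂ y) = b
combAdj b G H (inj₂ x) (inj₁ y) = b

combSym : ∀ {m k} b (G : Graph m) (H : Graph k) u v →
          combAdj b G H u v ≡ combAdj b G H v u
combSym b G H (inj₁ x) (inj₁ y) = sym G x y
combSym b G H (inj₂ x) (inj₂ y) = sym H x y
combSym b G H (inj₁ x) (inj₂ y) = _≡_.refl
combSym b G H (inj₂ x) (inj₁ y) = _≡_.refl

combIrr : ∀ {m k} b (G : Graph m) (H : Graph k) u → combAdj b G H u u ≡ false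
combIrr b G H (inj₁ x) = irref G x
combIrr b G H (inj₂ x) = irref H x

comb : ∀ {m k} → Bool → Graph m → Graph k → Graph (m + k)
comb {m} b G H = record
  { adj   = λ x y → combAdj b G H (splitAt m x) (splitAt m y)
  ; sym   = λ x y → combSym b G H (splitAt m x) (splitAt m y)
  ; irref = λ x → combIrr b G H (splitAt m x) }

_⊕_ : ∀ {m k} → Graph m → Graph k → Graph (m + k)
_⊕_ = comb false

_⊛_ : ∀ {m k} → Graph m → Graph k → Graph (m + k)
_⊛_ = comb true

data IsCograph : {n : ℕ} → Graph n → Set where
  single : IsCograph K₁
  union  : ∀ {m k} {G : Graph m} {H : Graph k} →
           IsCograph G → IsCograph H → IsCograph (G ⊕ H)
  join   : ∀ {m k} {G : Graph m} {H : Graph k} →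
           IsCograph G → IsCograph H → IsCograph (G ⊛ H)
  iso    : ∀ {m k} {G : Graph m} {H : Graph k} (f : Fin m ⤖ Fin k) →
           (∀ i j → adj H (Bijection.to f i) (Bijection.to f j) ≡ adj G i j) →
           IsCograph G → IsCograph H

data Path {n} (G : Graph n) (W : Subset n) : Fin n → Fin n → Set where
  here : ∀ {x} → x ∈ W → Path G W x x
  step : ∀ {x y z} → x ∈ W → adj G x y ≡ true → Path G W y z → Path G W x z

InducedConnected : ∀ {n} → Graph n → Subset n → Set
InducedConnected G W = ∀ x y → x ∈ W → y ∈ W → Path G W x y

-- Clutters: a d-uniform clutter on Fin n is given by its set of circuits,
-- a predicate on subsets (all circuits having d elements).

Clutter : ℕ → Set₁
Clutter n = Subset n → Set

Con : ∀ {n} → ℕ → Graph n → Clutter n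
Con r G W = (∣ W ∣ ≡ r) × InducedConnected G W

complementClutter : ∀ {n} → ℕ → Clutter n → Clutter n
complementClutter d C S = (∣ S ∣ ≡ d) × ¬ C S

IsClique : ∀ {n} → ℕ → Clutter n → (Fin n → Set) → Set
IsClique d C A = ∀ S → ∣ S ∣ ≡ d → (∀ x → x ∈ S → A x) → C S

Nbhd : ∀ {n} → Clutter n → Subset n → Fin n → Set
Nbhd C Z x = x ∈ Z ⊎ (x ∉ Z × ∃[ E ] (C E × x ∈ E × E ⊆ (Z ∪ ⁅ x ⁆)))

SimplicialMaxSubcircuit : ∀ {n} → ℕ → Clutter n → Subset n → Set
SimplicialMaxSubcircuit d C Z = (∣ Z ∣ + 1 ≡ d) × IsClique d C (Nbhd C Z)

removeSub : ∀ {n} → Clutter n → Subset n → Clutter n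
removeSub C Z E = C E × ¬ (Z ⊆ E)

data Chordal {n} (d : ℕ) : Clutter n → Set₁ where
  noCircuits : ∀ {C} → (∀ E → ¬ C E) → Chordal d C
  simplicial : ∀ {C} (Z : Subset n) → SimplicialMaxSubcircuit d C Z →
               Chordal d (removeSub C Z) → Chordal d C

CoChordal : ∀ {n} → ℕ → Clutter n → Set₁
CoChordal d C = Chordal d (complementClutter d C)

Disjoint : ∀ {n} → Subset n → Subset n → Set
Disjoint A B = Empty (A ∩ B)

IsInducedMatching : ∀ {n} → Clutter n → List (Subset n) → Set
IsInducedMatching C M =
  All C M × AllPairs Disjoint M ×
  (∀ W → C W → W ⊆ ⋃ M → W ∈ₗ M)

GapFree : ∀ {n} → ℕ → Graph n → Set
GapFree r G = ∀ M → IsInducedMatching (Con r G) M → length M ℕ.≤ 1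

-- Simplicial complexes on Fin n, given by their set of faces

Complex : ℕ → Set₁
Complex n = Subset n → Set

-- Σ_r(G): generated by the complements V(G) \ W of the circuits W of Con_r(G)
Σr : ∀ {n} → ℕ → Graph n → Complex n
Σr r G F = ∃[ W ] (Con r G W × Disjoint F W)

Facet : ∀ {n} → Complex n → Subset n → Set
Facet Δ F = Δ F × (∀ G → Δ G → F ⊆ G → G ≡ F)

del : ∀ {n} → Complex n → Fin n → Complex n
del Δ v F = Δ F × v ∉ F

lk : ∀ {n} → Complex n → Fin n → Complex n
lk Δ v F = v ∉ F × Δ (F ∪ ⁅ v ⁆)

lkF : ∀ {n} → Complex n → Subset n → Complex n
lkF Δ F G = Disjoint G F × Δ (G ∪ F)

-- vertex decomposability (non-pure version of Björner–Wachs)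
data VertexDecomposable {n} : Complex n → Set₁ where
  simplex  : ∀ {Δ} (F : Subset n) → (∀ G → Δ G ⇔ G ⊆ F) → VertexDecomposable Δ
  void     : ∀ {Δ} → (∀ G → ¬ Δ G) → VertexDecomposable Δ
  shedding : ∀ {Δ} (v : Fin n) → Δ ⁅ v ⁆ →
             (∀ F → Facet (lk Δ v) F → ¬ Facet (del Δ v) F) →
             VertexDecomposable (lk Δ v) → VertexDecomposable (del Δ v) →
             VertexDecomposable Δ

-- shellability (non-pure): an ordering F₁,…,F_m of all facets such that for
-- j ≥ 2 the complex ⟨F_j⟩ ∩ ⟨F₁,…,F_{j-1}⟩ is pure of dimension dim F_j − 1
PureOfSize : ∀ {n} → Complex n → ℕ → Set
PureOfSize Γ s = ∀ G → Facet Γ G → ∣ G ∣ ≡ s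

Shellable : ∀ {n} → Complex n → Set
Shellable {n} Δ =
  ∃[ L ] (Unique L × All (Facet Δ) L × (∀ F → Facet Δ F → F ∈ₗ L) ×
    (∀ (j : Fin (length L)) →
      PureOfSize (λ G → G ⊆ Data.List.lookup L j ×
                         ∃[ i ] (toℕ {length L} i < toℕ j × G ⊆ Data.List.lookup L i))
                 (ℕ.pred ∣ Data.List.lookup L j ∣)))
  where import Data.List

module _ {c ℓ} (K : Field c ℓ) where
  open Field K renaming (_+_ to _+ᴷ_)

  alt : ℕ → Carrier → Carrier
  alt zero    x = x
  alt (suc m) x = - alt m x

  below : ∀ {n} → Fin n → Subset n
  below v = tabulate (λ u → toℕ u <ᵇ toℕ v)

  ΣFin : ∀ {n} → (Fin n → Carrier) → Carrier
  ΣFin {n} f = foldr _+ᴷ_ 0# (map f (allFin n))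

  Chain : ∀ {n} → Complex n → ℕ → (Subset n → Carrier) → Set ℓ
  Chain Γ k x = ∀ S → ¬ (Γ S × ∣ S ∣ ≡ k) → x S ≈ 0#

  -- simplicial boundary with vertices ordered as in Fin n:
  -- (∂x)(T) = Σ_{v ∉ T} (−1)^{#{u ∈ T , u < v}} x(T ∪ {v})
  ∂ : ∀ {n} → (Subset n → Carrier) → Subset n → Carrier
  ∂ x T = ΣFin (λ v → if lookup T v then 0#
                      else alt ∣ T ∩ below v ∣ (x (T ∪ ⁅ v ⁆)))

  -- vanishing of reduced homology H̃_{k-1}(Γ; K) (chains on k-element faces)
  ReducedHomologyVanishes : ∀ {n} → Complex n → ℕ → Set (c ⊔ ℓ)
  ReducedHomologyVanishes {n} Γ k =
    ∀ (x : Subset n → Carrier) → Chain Γ k x → (∀ T → ∂ x T ≈ 0#) →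
    ∃[ y ] (Chain Γ (suc k) y × ∀ T → x T ≈ ∂ y T)

  -- Reisner: for every face F, H̃_i(lk F; K) = 0 for all i < dim lk F
  CohenMacaulay : ∀ {n} → Complex n → Set (c ⊔ ℓ)
  CohenMacaulay {n} Δ =
    ∀ F → Δ F → ∀ k → (∃[ G ] (lkF Δ F G × k < ∣ G ∣)) →
    ReducedHomologyVanishes (lkF Δ F) k

{-# OPTIONS --safe #-}

-- Everything passes through r-gap-freeness.  Call a d-uniform clutter C vertex splittable if it is
-- trivial or has a vertex v such that every circuit W ∌ v admits an exchange W − x + v ∈ C, and both
-- the deletion {W ∈ C : v ∉ W} and the contraction {W − v : v ∈ W ∈ C} are vertex splittable.
-- Vertex splittable clutters are closed under joins, and in a gap-free cograph a disjoint union has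
-- circuits on one side only, so Con_r(G) is vertex splittable by induction along the cotree.  In the
-- complex generated by the complements of the circuits, v is then a shedding vertex whose link comes
-- from the deletion and whose deletion comes from the contraction; this yields vertex
-- decomposability, a shelling (linear quotients) and, cone by cone, the vanishing of homology, while
-- in the complementary clutter the circuits through v can be eliminated by lifting an elimination
-- of the complement of the contraction.
--
-- Conversely, a failure of gap-freeness gives two disjoint circuits A, B with no further circuit in
-- A ∪ B.  The link of the complement of A ∪ B is then the disjoint union of the simplices on A
-- and B, which excludes the three topological conditions, and in the complementary clutter on A ∪ B
-- no simplicial maximal subcircuit exists.
module Submission where

open import Defs
open import Level using (Level)
import Algebra.Bundles
import Algebra.Properties.AbelianGroup
import Algebra.Properties.CommutativeMonoid.Sum
import Algebra.Properties.Group
open import Data.Bool using (Bool; true; false; if_then_else_)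
import Data.Bool.Properties as Boolₚ
import Data.Empty as Empty
open import Data.Empty using (⊥-elim)
open import Data.Fin using (Fin; zero; suc; toℕ; splitAt; _↑ˡ_; _↑ʳ_)
import Data.Fin.Properties as Finₚ
open import Data.Fin.Subset
  using (Subset; _∈_; _∉_; _⊆_; _∪_; _∩_; _-_; ⁅_⁆; ∣_∣; ∁; ⊥; ⊤; Empty; Nonempty)
open import Data.Fin.Subset.Properties
open import Data.List as List using (List; []; _∷_; length)
open import Data.List.Membership.Propositional using () renaming (_∈_ to _∈ₗ_)
open import Data.List.Membership.Propositional.Properties
  using (∈-map⁺; ∈-map⁻; ∈-++⁺ˡ; ∈-++⁺ʳ; ∈-++⁻; ∈-lookup)
import Data.List.Properties as Listₚ
open import Data.List.Relation.Unary.All as All using (All; []; _∷_)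
import Data.List.Relation.Unary.All.Properties as Allₚ
open import Data.List.Relation.Unary.AllPairs using ([]; _∷_)
open import Data.List.Relation.Unary.Any as Any using (here; there)
open import Data.List.Relation.Unary.Any.Properties using (lookup-index)
open import Data.List.Relation.Unary.Unique.Propositional using (Unique)
import Data.List.Relation.Unary.Unique.Propositional.Properties as Uniqueₚ
open import Data.Nat as ℕ using (ℕ; zero; suc; _+_; _≤_; _<_; z≤n; s≤s)
import Data.Nat.Properties as ℕₚ
open import Data.Product as Product using (∃; ∃-syntax; _×_; _,_; proj₁; proj₂)
open import Data.Sum as Sum using (_⊎_; inj₁; inj₂)
open import Data.Vec as Vec using ([]; _∷_)
import Data.Vec.Properties as Vecₚ
open import Function.Base using (_∘_; id)
open import Function.Bundles using (_⇔_; mk⇔; Equivalence; Bijection)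
open import Function.Definitions using (Injective)
open import Relation.Binary.Definitions using (DecidableEquality; tri<; tri≈; tri>)
open import Relation.Binary.PropositionalEquality as ≡
  using (_≡_; _≢_; refl; cong; subst; trans)
import Relation.Binary.Reasoning.Setoid
open import Relation.Nullary using (¬_; Dec; yes; no)
import Relation.Nullary.Decidable as Dec
open import Relation.Nullary.Decidable using (⌊_⌋)

open Equivalence using (to; from)

variable
  n d : ℕ

-- Subsets of a finite set: insertion, removal, disjointness, cardinality.

x∉p-x : ∀ (p : Subset n) x → x ∉ p - x
x∉p-x (_ ∷ p) (suc x) (Vec.there x∈) = x∉p-x p x x∈

x∈p-y⇒x∈p : ∀ (p : Subset n) {x y} → x ∈ p - y → x ∈ p
x∈p-y⇒x∈p p = p─q⊆p p _

x∈p-y⇒x≢y : ∀ (p : Subset n) {x y} → x ∈ p - y → x ≢ y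
x∈p-y⇒x≢y p x∈ refl = x∉p-x p _ x∈

x∈p⇒x∈p∪q : ∀ {p q : Subset n} {x} → x ∈ p → x ∈ p ∪ q
x∈p⇒x∈p∪q = p⊆p∪q _

x∈q⇒x∈p∪q : ∀ {p q : Subset n} {x} → x ∈ q → x ∈ p ∪ q
x∈q⇒x∈p∪q = q⊆p∪q _ _

y∈p∪⁅y⁆ : ∀ {p : Subset n} {y} → y ∈ p ∪ ⁅ y ⁆
y∈p∪⁅y⁆ = x∈q⇒x∈p∪q (x∈⁅x⁆ _)

x∈p∪⁅y⁆⁻ : ∀ (p : Subset n) {x y} → x ∈ p ∪ ⁅ y ⁆ → x ∈ p ⊎ x ≡ y
x∈p∪⁅y⁆⁻ p x∈ = Sum.map₂ (x∈⁅y⁆⇒x≡y _) (x∈p∪q⁻ p _ x∈)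

x∈p∪⁅y⁆∧x≢y⇒x∈p : ∀ (p : Subset n) {x y} → x ∈ p ∪ ⁅ y ⁆ → x ≢ y → x ∈ p
x∈p∪⁅y⁆∧x≢y⇒x∈p p x∈ x≢y = Sum.[ id , ⊥-elim ∘ x≢y ] (x∈p∪⁅y⁆⁻ p x∈)

∪-⊆ : ∀ {p q s : Subset n} → p ⊆ s → q ⊆ s → p ∪ q ⊆ s
∪-⊆ {p = p} {q} p⊆s q⊆s x∈ = Sum.[ p⊆s , q⊆s ] (x∈p∪q⁻ p q x∈)

∪⁅⁆-⊆ : ∀ {p s : Subset n} {y} → p ⊆ s → y ∈ s → p ∪ ⁅ y ⁆ ⊆ s
∪⁅⁆-⊆ p⊆s y∈s = ∪-⊆ p⊆s (λ x∈ → subst (_∈ _) (≡.sym (x∈⁅y⁆⇒x≡y _ x∈)) y∈s)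

∪-monoˡ-⊆ : ∀ {p q s : Subset n} → p ⊆ q → p ∪ s ⊆ q ∪ s
∪-monoˡ-⊆ p⊆q = ∪-⊆ (λ x∈ → x∈p⇒x∈p∪q (p⊆q x∈)) x∈q⇒x∈p∪q

-⊆-mono : ∀ {p q : Subset n} {y} → p ⊆ q → p - y ⊆ q - y
-⊆-mono {p = p} p⊆q x∈ = x∈p∧x≢y⇒x∈p-y (p⊆q (x∈p-y⇒x∈p p x∈)) (x∈p-y⇒x≢y p x∈)

p⊆q-y : ∀ {p q : Subset n} {y} → p ⊆ q → y ∉ p → p ⊆ q - y
p⊆q-y p⊆q y∉p x∈ = x∈p∧x≢y⇒x∈p-y (p⊆q x∈) λ { refl → y∉p x∈ }

p∪⁅y⁆-y≡p : ∀ {p : Subset n} {y} → y ∉ p → (p ∪ ⁅ y ⁆) - y ≡ p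
p∪⁅y⁆-y≡p {p = p} {y} y∉p = ⊆-antisym
  (λ x∈ → x∈p∪⁅y⁆∧x≢y⇒x∈p p (x∈p-y⇒x∈p (p ∪ ⁅ y ⁆) x∈) (x∈p-y⇒x≢y (p ∪ ⁅ y ⁆) x∈))
  (p⊆q-y x∈p⇒x∈p∪q y∉p)

p⊆p-y∪⁅y⁆ : ∀ (p : Subset n) y → p ⊆ (p - y) ∪ ⁅ y ⁆
p⊆p-y∪⁅y⁆ p y {x} x∈ with x Finₚ.≟ y
... | yes refl = y∈p∪⁅y⁆
... | no x≢y = x∈p⇒x∈p∪q (x∈p∧x≢y⇒x∈p-y x∈ x≢y)

p-y∪⁅y⁆≡p : ∀ {p : Subset n} {y} → y ∈ p → (p - y) ∪ ⁅ y ⁆ ≡ p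
p-y∪⁅y⁆≡p {p = p} {y} y∈p = ⊆-antisym (∪⁅⁆-⊆ (x∈p-y⇒x∈p p) y∈p) (p⊆p-y∪⁅y⁆ p y)

∪⁅⁆-injective : ∀ {p q : Subset n} {y} → y ∉ p → y ∉ q → p ∪ ⁅ y ⁆ ≡ q ∪ ⁅ y ⁆ → p ≡ q
∪⁅⁆-injective y∉p y∉q eq =
  trans (≡.sym (p∪⁅y⁆-y≡p y∉p)) (trans (cong (_- _) eq) (p∪⁅y⁆-y≡p y∉q))

Disjoint-sym : ∀ {p q : Subset n} → Disjoint p q → Disjoint q p
Disjoint-sym {p = p} {q} dis (x , x∈) =
  dis (x , x∈p∩q⁺ (Product.swap (x∈p∩q⁻ q p x∈)))

disjoint : ∀ {p q : Subset n} → (∀ {x} → x ∈ p → x ∉ q) → Disjoint p q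
disjoint {p = p} {q} f (x , x∈) = let x∈p , x∈q = x∈p∩q⁻ p q x∈ in f x∈p x∈q

disjoint⁻ : ∀ {p q : Subset n} → Disjoint p q → ∀ {x} → x ∈ p → x ∉ q
disjoint⁻ dis x∈p x∈q = dis (_ , x∈p∩q⁺ (x∈p , x∈q))

∣p∪q∣≡∣p∣+∣q∣ : ∀ (p q : Subset n) → Disjoint p q → ∣ p ∪ q ∣ ≡ ∣ p ∣ + ∣ q ∣
∣p∪q∣≡∣p∣+∣q∣ [] [] _ = refl
∣p∪q∣≡∣p∣+∣q∣ (true ∷ p) (true ∷ q) dis = ⊥-elim (dis (zero , Vec.here))
∣p∪q∣≡∣p∣+∣q∣ (true ∷ p) (false ∷ q) dis =
  cong suc (∣p∪q∣≡∣p∣+∣q∣ p q λ { (x , x∈) → dis (suc x , Vec.there x∈) })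
∣p∪q∣≡∣p∣+∣q∣ (false ∷ p) (true ∷ q) dis =
  trans (cong suc (∣p∪q∣≡∣p∣+∣q∣ p q λ { (x , x∈) → dis (suc x , Vec.there x∈) }))
        (≡.sym (ℕₚ.+-suc ∣ p ∣ ∣ q ∣))
∣p∪q∣≡∣p∣+∣q∣ (false ∷ p) (false ∷ q) dis =
  ∣p∪q∣≡∣p∣+∣q∣ p q λ { (x , x∈) → dis (suc x , Vec.there x∈) }

∣p∪⁅y⁆∣ : ∀ {p : Subset n} {y} → y ∉ p → ∣ p ∪ ⁅ y ⁆ ∣ ≡ suc ∣ p ∣
∣p∪⁅y⁆∣ {p = p} {y} y∉p =
  trans (∣p∪q∣≡∣p∣+∣q∣ p ⁅ y ⁆ (disjoint λ x∈p x∈y → y∉p (subst (_∈ p) (x∈⁅y⁆⇒x≡y y x∈y) x∈p)))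
  (trans (cong (∣ p ∣ +_) (∣⁅x⁆∣≡1 y)) (ℕₚ.+-comm _ 1))

∣p∣≡1+∣p-y∣ : ∀ {p : Subset n} {y} → y ∈ p → ∣ p ∣ ≡ suc ∣ p - y ∣
∣p∣≡1+∣p-y∣ {p = p} {y} y∈p =
  trans (cong ∣_∣ (≡.sym (p-y∪⁅y⁆≡p y∈p))) (∣p∪⁅y⁆∣ (x∉p-x p y))

∣p-y∣≡ : ∀ {p : Subset n} {y k} → y ∈ p → ∣ p ∣ ≡ suc k → ∣ p - y ∣ ≡ k
∣p-y∣≡ y∈p eq = ℕₚ.suc-injective (trans (≡.sym (∣p∣≡1+∣p-y∣ y∈p)) eq)

∣p-x∪⁅y⁆∣ : ∀ {p : Subset n} {x y} → x ∈ p → y ∉ p → ∣ (p - x) ∪ ⁅ y ⁆ ∣ ≡ ∣ p ∣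
∣p-x∪⁅y⁆∣ {p = p} x∈p y∉p =
  trans (∣p∪⁅y⁆∣ (y∉p ∘ x∈p-y⇒x∈p p)) (≡.sym (∣p∣≡1+∣p-y∣ x∈p))

p⊆q∧∣q∣≤∣p∣⇒p≡q : ∀ {p q : Subset n} → p ⊆ q → ∣ q ∣ ≤ ∣ p ∣ → p ≡ q
p⊆q∧∣q∣≤∣p∣⇒p≡q {p = p} {q} p⊆q le = ⊆-antisym p⊆q q⊆p
  where
  q⊆p : q ⊆ p
  q⊆p {x} x∈q with x ∈? p
  ... | yes x∈p = x∈p
  ... | no x∉p = ⊥-elim (ℕₚ.<⇒≱ (p⊂q⇒∣p∣<∣q∣ (p⊆q , x , x∈q , x∉p)) le)

∣p∣≡0⇒p≡⊥ : ∀ {p : Subset n} → ∣ p ∣ ≡ 0 → p ≡ ⊥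
∣p∣≡0⇒p≡⊥ {n} {p} eq =
  ≡.sym (p⊆q∧∣q∣≤∣p∣⇒p≡q ⊥⊆ (subst (_≤ ∣ ⊥ {n} ∣) (≡.sym eq) z≤n))

∣p∣≡1+k⇒Nonempty : ∀ {p : Subset n} {k} → ∣ p ∣ ≡ suc k → Nonempty p
∣p∣≡1+k⇒Nonempty {n} {p} eq with nonempty? p
... | yes ne = ne
... | no e with trans (≡.sym eq) (trans (cong ∣_∣ (Empty-unique e)) (∣⊥∣≡0 n))
...   | ()

Empty⇒∣p∣≡0 : ∀ {p : Subset n} → Empty p → ∣ p ∣ ≡ 0
Empty⇒∣p∣≡0 {n} e = trans (cong ∣_∣ (Empty-unique e)) (∣⊥∣≡0 n)

∣∁p∣+∣p∣≡n : ∀ (p : Subset n) → ∣ ∁ p ∣ + ∣ p ∣ ≡ n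
∣∁p∣+∣p∣≡n p = trans (cong (_+ ∣ p ∣) (∣∁p∣≡n∸∣p∣ p)) (ℕₚ.m∸n+n≡m (∣p∣≤n p))

-- Vertex splittable clutters

deletion contraction : Clutter n → Fin n → Clutter n
deletion C v W = C W × v ∉ W
contraction C v W = v ∉ W × C (W ∪ ⁅ v ⁆)

Exchange : Clutter n → Fin n → Set
Exchange C v = ∀ W → C W → v ∉ W → ∃[ x ] (x ∈ W × C ((W - x) ∪ ⁅ v ⁆))

-- The clutter form of a vertex splittable ideal `I = vJ + K`: `J` comes from the contraction, `K`
-- from the deletion, and `Exchange` says that `K` lies in `J`. The ground set `U` contains all
-- circuits and loses `v` at each split. The decision in `rank0` makes it decidable whether there is
-- a circuit at all.
data VertexSplittable {n} (U : Subset n) : (d : ℕ) → Clutter n → Set₁ where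
  rank0 : ∀ {C} → Dec (C ⊥) → (∀ W → C W → W ≡ ⊥) → VertexSplittable U 0 C
  empty : ∀ {d C} → Empty U → (∀ W → ¬ C W) → VertexSplittable U (suc d) C
  split : ∀ {d C} v → v ∈ U → Exchange C v →
          VertexSplittable (U - v) (suc d) (deletion C v) →
          VertexSplittable (U - v) d (contraction C v) →
          VertexSplittable U (suc d) C

contraction-∋ : ∀ {C : Clutter n} {v W} → C W → v ∈ W → contraction C v (W - v)
contraction-∋ {C = C} {v} {W} CW v∈W = x∉p-x W v , subst C (≡.sym (p-y∪⁅y⁆≡p v∈W)) CW

module _ {n : ℕ} where

  VS-bounded : ∀ {U : Subset n} {d C W} → VertexSplittable U d C → C W → ∣ W ∣ ≡ d × W ⊆ U
  VS-bounded (rank0 _ only) CW with refl ← only _ CW = ∣⊥∣≡0 n , ⊥⊆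
  VS-bounded (empty _ none) CW = ⊥-elim (none _ CW)
  VS-bounded {U = U} {C = C} {W} (split v v∈U _ vsD vsC) CW with v ∈? W
  ... | no v∉W = let card , W⊆ = VS-bounded vsD (CW , v∉W) in card , x∈p-y⇒x∈p U ∘ W⊆
  ... | yes v∈W with VS-bounded vsC (contraction-∋ {C = C} CW v∈W)
  ...   | card , W⊆ = trans (∣p∣≡1+∣p-y∣ v∈W) (cong suc card)
                    , ∪⁅⁆-⊆ (x∈p-y⇒x∈p U ∘ W⊆) v∈U ∘ p⊆p-y∪⁅y⁆ W v

  -- Circuits form an arbitrary predicate, so the decision is read off from the leaves of the
  -- splitting. The case distinctions at disjoint unions and at shedding vertices rest on it.
  VS-inhabited? : ∀ {U : Subset n} {d C} → VertexSplittable U d C → ∃ C ⊎ (∀ W → ¬ C W)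
  VS-inhabited? (rank0 (yes C⊥) _) = inj₁ (_ , C⊥)
  VS-inhabited? {C = C} (rank0 (no ¬C⊥) only) = inj₂ λ W CW → ¬C⊥ (subst C (only W CW) CW)
  VS-inhabited? (empty _ none) = inj₂ none
  VS-inhabited? {C = C} (split v _ _ vsD vsC) with VS-inhabited? vsD | VS-inhabited? vsC
  ... | inj₁ (W , CW , _) | _ = inj₁ (W , CW)
  ... | inj₂ _ | inj₁ (W , _ , CW) = inj₁ (_ , CW)
  ... | inj₂ noD | inj₂ noC = inj₂ none
    where
    none : ∀ W → ¬ C W
    none W CW with v ∈? W
    ... | yes v∈W = noC _ (contraction-∋ {C = C} CW v∈W)
    ... | no v∉W = noD W (CW , v∉W)

  private
    -- Without circuits the exchange is vacuous, so any vertex of `U` splits. The recursion runs on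
    -- `k`, the size of `U`.
    VS-void′ : ∀ k {U : Subset n} {d C} → ∣ U ∣ ≡ k → (∀ W → ¬ C W) → VertexSplittable U d C
    VS-void′ _ {d = zero} _ none = rank0 (no (none _)) λ W CW → ⊥-elim (none W CW)
    VS-void′ zero {d = suc d} eq none =
      empty (λ { (x , x∈U) → ℕₚ.1+n≢0 (trans (≡.sym (∣p∣≡1+∣p-y∣ x∈U)) eq) }) none
    VS-void′ (suc k) {d = suc d} eq none with ∣p∣≡1+k⇒Nonempty eq
    ... | v , v∈U = split v v∈U (λ W CW → ⊥-elim (none W CW))
      (VS-void′ k (∣p-y∣≡ v∈U eq) λ W → none W ∘ proj₁)
      (VS-void′ k (∣p-y∣≡ v∈U eq) λ W → none _ ∘ proj₂)

  VS-void : ∀ {U : Subset n} {d C} → (∀ W → ¬ C W) → VertexSplittable U d C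
  VS-void = VS-void′ _ refl

  VS-mono : ∀ {U U′ : Subset n} {d C C′} → VertexSplittable U d C → U ⊆ U′ →
            (∀ W → C W ⇔ C′ W) → VertexSplittable U′ d C′
  VS-mono (rank0 C⊥? only) _ eq =
    rank0 (Dec.map (eq _) C⊥?) (λ W → only W ∘ from (eq W))
  -- `U′` may be nonempty, so the constructor `empty` need not apply.
  VS-mono (empty _ none) _ eq = VS-void λ W → none W ∘ from (eq W)
  VS-mono {C′ = C′} (split v v∈U exch vsD vsC) U⊆U′ eq = split v (U⊆U′ v∈U)
    (λ W CW v∉W → let x , x∈W , CW′ = exch W (from (eq W) CW) v∉W in x , x∈W , to (eq _) CW′)
    (VS-mono vsD (-⊆-mono U⊆U′) λ W →
      mk⇔ (Product.map₁ (to (eq W))) (Product.map₁ (from (eq W))))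
    (VS-mono vsC (-⊆-mono U⊆U′) λ W →
      mk⇔ (Product.map₂ (to (eq _))) (Product.map₂ (from (eq _))))

  -- Links in the complement complex belong to restricted clutters. If `v` lies outside `U′`, only
  -- circuits of the deletion survive; otherwise an exchange stays inside `U′`, because it adds
  -- nothing but `v`.
  VS-restrict : ∀ {U : Subset n} {d C} → VertexSplittable U d C → ∀ U′ →
                VertexSplittable U′ d (λ W → C W × W ⊆ U′)
  VS-restrict (rank0 C⊥? only) U′ =
    rank0 (Dec.map′ (λ C⊥ → C⊥ , ⊥⊆) proj₁ C⊥?) (λ W → only W ∘ proj₁)
  VS-restrict (empty _ none) U′ = VS-void λ W → none W ∘ proj₁
  VS-restrict {C = C} (split v v∈U exch vsD vsC) U′ with v ∈? U′
  ... | no v∉U′ = VS-mono (VS-restrict vsD U′) id λ W → mk⇔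
    (λ { ((CW , _) , W⊆) → CW , W⊆ }) (λ { (CW , W⊆) → (CW , v∉U′ ∘ W⊆) , W⊆ })
  ... | yes v∈U′ = split v v∈U′
    (λ { W (CW , W⊆) v∉W → let x , x∈W , CW′ = exch W CW v∉W in
         x , x∈W , CW′ , ∪⁅⁆-⊆ (W⊆ ∘ x∈p-y⇒x∈p W) v∈U′ })
    (VS-mono (VS-restrict vsD (U′ - v)) id λ W → mk⇔
      (λ { ((CW , v∉W) , W⊆) → (CW , x∈p-y⇒x∈p U′ ∘ W⊆) , v∉W })
      (λ { ((CW , W⊆) , v∉W) → (CW , v∉W) , p⊆q-y W⊆ v∉W }))
    (VS-mono (VS-restrict vsC (U′ - v)) id λ W → mk⇔
      (λ { ((v∉W , CW) , W⊆) → v∉W , CW , ∪⁅⁆-⊆ (x∈p-y⇒x∈p U′ ∘ W⊆) v∈U′ })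
      (λ { (v∉W , CW , W⊆) → (v∉W , CW) , p⊆q-y (W⊆ ∘ x∈p⇒x∈p∪q) v∉W }))

  Complete : Subset n → ℕ → Clutter n
  Complete U d W = ∣ W ∣ ≡ d × W ⊆ U

  private
    VS-complete′ : ∀ k {U : Subset n} {d} → ∣ U ∣ ≡ k → VertexSplittable U d (Complete U d)
    VS-complete′ _ {d = zero} _ =
      rank0 (yes (∣⊥∣≡0 n , ⊥⊆)) λ W → ∣p∣≡0⇒p≡⊥ ∘ proj₁
    VS-complete′ zero {U} {d = suc d} eq = VS-void λ { W (card , W⊆U) →
      ℕₚ.<⇒≱ (s≤s z≤n) (subst (_≤ 0) card (subst (∣ W ∣ ≤_) eq (p⊆q⇒∣p∣≤∣q∣ W⊆U))) }
    VS-complete′ (suc k) {U} {d = suc d} eq with ∣p∣≡1+k⇒Nonempty eq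
    ... | v , v∈U = split v v∈U
      (λ { W (card , W⊆U) v∉W → let x , x∈W = ∣p∣≡1+k⇒Nonempty card in
           x , x∈W , trans (∣p-x∪⁅y⁆∣ x∈W v∉W) card , ∪⁅⁆-⊆ (W⊆U ∘ x∈p-y⇒x∈p W) v∈U })
      (VS-mono (VS-complete′ k (∣p-y∣≡ v∈U eq)) id λ W → mk⇔
        (λ { (card , W⊆) → (card , x∈p-y⇒x∈p U ∘ W⊆) , x∉p-x U v ∘ W⊆ })
        (λ { ((card , W⊆) , v∉W) → card , p⊆q-y W⊆ v∉W }))
      (VS-mono (VS-complete′ k (∣p-y∣≡ v∈U eq)) id λ W → mk⇔
        (λ { (card , W⊆) → let v∉W = x∉p-x U v ∘ W⊆ in
             v∉W , trans (∣p∪⁅y⁆∣ v∉W) (cong suc card) , ∪⁅⁆-⊆ (x∈p-y⇒x∈p U ∘ W⊆) v∈U })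
        (λ { (v∉W , card , W⊆) →
             ℕₚ.suc-injective (trans (≡.sym (∣p∪⁅y⁆∣ v∉W)) card) , p⊆q-y (W⊆ ∘ x∈p⇒x∈p∪q) v∉W }))

  VS-complete : ∀ {U : Subset n} {d} → VertexSplittable U d (Complete U d)
  VS-complete = VS-complete′ _ refl

  Meets : Subset n → Subset n → Set
  Meets V W = ∃[ x ] (x ∈ V × x ∈ W)

  meets-⊆ : ∀ {U V W : Subset n} → W ⊆ U ∪ V → (∀ {x} → x ∈ V → x ∉ W) → W ⊆ U
  meets-⊆ {U} {V} W⊆ V∌ x∈W = Sum.[ id , (λ x∈V → ⊥-elim (V∌ x∈V x∈W)) ] (x∈p∪q⁻ U V (W⊆ x∈W))

  -- The contraction of a join at a vertex of U.
  Up : Subset n → Subset n → ℕ → Clutter n → Clutter n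
  Up U V d D W = (Complete (U ∪ V) d W × Meets V W) ⊎ D W

  private
    -- Split at the vertices of `V` one by one. A set through `v ∈ V` meets `V` automatically, so
    -- the contraction at `v` is complete and any element can be exchanged for `v`. Once `V` is used
    -- up, `D` remains.
    VS-up′ : ∀ k {U V : Subset n} {d D} → ∣ V ∣ ≡ k → Disjoint U V →
             VertexSplittable U (suc d) D → VertexSplittable (U ∪ V) (suc d) (Up U V (suc d) D)
    VS-up′ zero eq _ vs = VS-mono vs x∈p⇒x∈p∪q λ W → mk⇔ inj₂
      λ { (inj₁ (_ , x , x∈V , _)) → ⊥-elim (ℕₚ.1+n≢0 (trans (≡.sym (∣p∣≡1+∣p-y∣ x∈V)) eq))
        ; (inj₂ DW) → DW }
    VS-up′ (suc k) {U} {V} {d} {D} eq dis vs with ∣p∣≡1+k⇒Nonempty eq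
    ... | v , v∈V = split v v∈UV exch
      (VS-mono (VS-up′ k (∣p-y∣≡ v∈V eq) (disjoint λ x∈U → disjoint⁻ dis x∈U ∘ x∈p-y⇒x∈p V) vs)
        U∪[V-v]⊆ λ W → mk⇔
        (λ { (inj₁ ((card , W⊆) , x , x∈V , x∈W)) →
               inj₁ ((card , x∈p-y⇒x∈p (U ∪ V) ∘ U∪[V-v]⊆ ∘ W⊆) , x , x∈p-y⇒x∈p V x∈V , x∈W)
               , x∉p-x (U ∪ V) v ∘ U∪[V-v]⊆ ∘ W⊆
           ; (inj₂ DW) → inj₂ DW , λ v∈W → v∉U (proj₂ (VS-bounded vs DW) v∈W) })
        (λ { (inj₁ ((card , W⊆) , x , x∈V , x∈W) , v∉W) →
               inj₁ ((card , [U∪V]-v⊆ ∘ p⊆q-y W⊆ v∉W)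
                    , x , x∈p∧x≢y⇒x∈p-y x∈V (λ { refl → v∉W x∈W }) , x∈W)
           ; (inj₂ DW , _) → inj₂ DW }))
      (VS-mono VS-complete id λ W → mk⇔
        (λ { (card , W⊆) → let v∉W = x∉p-x (U ∪ V) v ∘ W⊆ in
             v∉W , inj₁ (( trans (∣p∪⁅y⁆∣ v∉W) (cong suc card)
                         , ∪⁅⁆-⊆ (x∈p-y⇒x∈p (U ∪ V) ∘ W⊆) v∈UV)
                        , v , v∈V , y∈p∪⁅y⁆) })
        (λ { (v∉W , inj₁ ((card , W⊆) , _)) →
               ℕₚ.suc-injective (trans (≡.sym (∣p∪⁅y⁆∣ v∉W)) card) , p⊆q-y (W⊆ ∘ x∈p⇒x∈p∪q) v∉W
           ; (v∉W , inj₂ DW) → ⊥-elim (v∉U (proj₂ (VS-bounded vs DW) y∈p∪⁅y⁆)) }))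
      where
      v∈UV : v ∈ U ∪ V
      v∈UV = x∈q⇒x∈p∪q v∈V
      v∉U : v ∉ U
      v∉U v∈U = disjoint⁻ dis v∈U v∈V
      U∪[V-v]⊆ : U ∪ (V - v) ⊆ (U ∪ V) - v
      U∪[V-v]⊆ = ∪-⊆ (p⊆q-y x∈p⇒x∈p∪q v∉U) (-⊆-mono x∈q⇒x∈p∪q)
      [U∪V]-v⊆ : (U ∪ V) - v ⊆ U ∪ (V - v)
      [U∪V]-v⊆ x∈ with x∈p∪q⁻ U V (x∈p-y⇒x∈p (U ∪ V) x∈)
      ... | inj₁ x∈U = x∈p⇒x∈p∪q x∈U
      ... | inj₂ x∈V = x∈q⇒x∈p∪q (x∈p∧x≢y⇒x∈p-y x∈V (x∈p-y⇒x≢y (U ∪ V) x∈))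
      replace : ∀ {W} → Complete (U ∪ V) (suc d) W → v ∉ W →
                ∃[ x ] (x ∈ W × Up U V (suc d) D ((W - x) ∪ ⁅ v ⁆))
      replace {W} (card , W⊆) v∉W with ∣p∣≡1+k⇒Nonempty card
      ... | x , x∈W = x , x∈W , inj₁
        ((trans (∣p-x∪⁅y⁆∣ x∈W v∉W) card , ∪⁅⁆-⊆ (W⊆ ∘ x∈p-y⇒x∈p W) v∈UV) , v , v∈V , y∈p∪⁅y⁆)
      exch : Exchange (Up U V (suc d) D) v
      exch W (inj₁ (complete , _)) = replace complete
      exch W (inj₂ DW) = let card , W⊆ = VS-bounded vs DW in replace (card , x∈p⇒x∈p∪q ∘ W⊆)

  VS-up : ∀ {U V : Subset n} {d D} → Disjoint U V →
          VertexSplittable U (suc d) D → VertexSplittable (U ∪ V) (suc d) (Up U V (suc d) D)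
  VS-up = VS-up′ _ refl

  -- The shape of `Con` on a graph join: a set that meets both sides is always connected.
  Join : Subset n → Subset n → ℕ → Clutter n → Clutter n → Clutter n
  Join U V d C D W = (Complete (U ∪ V) d W × Meets U W × Meets V W) ⊎ (C W ⊎ D W)

  -- Follow the splitting of `C`. Deleting `v` leaves a join over `U - v`. Contracting `v` admits
  -- every set of the right size that meets `V` and discards `D`, which is the clutter `Up`.
  VS-join : ∀ {U V : Subset n} {d C D} → Disjoint U V →
            VertexSplittable U (2 + d) C → VertexSplittable V (2 + d) D →
            VertexSplittable (U ∪ V) (2 + d) (Join U V (2 + d) C D)
  VS-join dis (empty U-empty none) vsV = VS-mono vsV x∈q⇒x∈p∪q λ W → mk⇔
    (inj₂ ∘ inj₂)
    λ { (inj₁ (_ , (x , x∈U , _) , _)) → ⊥-elim (U-empty (x , x∈U))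
      ; (inj₂ (inj₁ CW)) → ⊥-elim (none W CW)
      ; (inj₂ (inj₂ DW)) → DW }
  VS-join {U} {V} {d} {C} {D} dis (split v v∈U exchC vsD vsC) vsV = split v v∈UV exch
    (VS-mono (VS-join dis′ vsD vsV) ⊆₁ λ W → mk⇔
      (λ { (inj₁ ((card , W⊆) , (x , x∈U , x∈W) , mV)) →
             inj₁ ((card , x∈p-y⇒x∈p (U ∪ V) ∘ ⊆₁ ∘ W⊆) , (x , x∈p-y⇒x∈p U x∈U , x∈W) , mV)
             , x∉p-x (U ∪ V) v ∘ ⊆₁ ∘ W⊆
         ; (inj₂ (inj₁ (CW , v∉W))) → inj₂ (inj₁ CW) , v∉W
         ; (inj₂ (inj₂ DW)) → inj₂ (inj₂ DW) , λ v∈W → v∉V (proj₂ (VS-bounded vsV DW) v∈W) })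
      (λ { (inj₁ ((card , W⊆) , (x , x∈U , x∈W) , mV) , v∉W) →
             inj₁ ((card , ⊆₂ ∘ p⊆q-y W⊆ v∉W)
                  , (x , x∈p∧x≢y⇒x∈p-y x∈U (λ { refl → v∉W x∈W }) , x∈W) , mV)
         ; (inj₂ (inj₁ CW) , v∉W) → inj₂ (inj₁ (CW , v∉W))
         ; (inj₂ (inj₂ DW) , v∉W) → inj₂ (inj₂ DW) }))
    (VS-mono (VS-up dis′ vsC) ⊆₁ λ W → mk⇔
      (λ { (inj₁ ((card , W⊆) , x , x∈V , x∈W)) →
             let v∉W = x∉p-x (U ∪ V) v ∘ ⊆₁ ∘ W⊆ in
             v∉W , inj₁ (( trans (∣p∪⁅y⁆∣ v∉W) (cong suc card)
                         , ∪⁅⁆-⊆ (x∈p-y⇒x∈p (U ∪ V) ∘ ⊆₁ ∘ W⊆) v∈UV)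
                        , (v , v∈U , y∈p∪⁅y⁆) , (x , x∈V , x∈p⇒x∈p∪q x∈W))
         ; (inj₂ (v∉W , CW)) → v∉W , inj₂ (inj₁ CW) })
      (λ { (v∉W , inj₁ ((card , W⊆) , _ , (x , x∈V , x∈W))) →
             inj₁ (( ℕₚ.suc-injective (trans (≡.sym (∣p∪⁅y⁆∣ v∉W)) card)
                   , ⊆₂ ∘ p⊆q-y (W⊆ ∘ x∈p⇒x∈p∪q) v∉W)
                  , x , x∈V , x∈p∪⁅y⁆∧x≢y⇒x∈p W x∈W λ { refl → v∉V x∈V })
         ; (v∉W , inj₂ (inj₁ CW)) → inj₂ (v∉W , CW)
         ; (v∉W , inj₂ (inj₂ DW)) → ⊥-elim (v∉V (proj₂ (VS-bounded vsV DW) y∈p∪⁅y⁆)) }))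
    where
    v∈UV : v ∈ U ∪ V
    v∈UV = x∈p⇒x∈p∪q v∈U
    v∉V : v ∉ V
    v∉V = disjoint⁻ dis v∈U
    dis′ : Disjoint (U - v) V
    dis′ = disjoint λ x∈U → disjoint⁻ dis (x∈p-y⇒x∈p U x∈U)
    ⊆₁ : (U - v) ∪ V ⊆ (U ∪ V) - v
    ⊆₁ = ∪-⊆ (-⊆-mono x∈p⇒x∈p∪q) (p⊆q-y x∈q⇒x∈p∪q v∉V)
    ⊆₂ : (U ∪ V) - v ⊆ (U - v) ∪ V
    ⊆₂ x∈ with x∈p∪q⁻ U V (x∈p-y⇒x∈p (U ∪ V) x∈)
    ... | inj₁ x∈U = x∈p⇒x∈p∪q (x∈p∧x≢y⇒x∈p-y x∈U (x∈p-y⇒x≢y (U ∪ V) x∈))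
    ... | inj₂ x∈V = x∈q⇒x∈p∪q x∈V
    replace : ∀ {W a b} → Complete (U ∪ V) (2 + d) W → v ∉ W → a ∈ W → b ∈ V → b ∈ W → b ≢ a →
              ∃[ x ] (x ∈ W × Join U V (2 + d) C D ((W - x) ∪ ⁅ v ⁆))
    replace {W} {a} {b} (card , W⊆) v∉W a∈W b∈V b∈W b≢a = a , a∈W , inj₁
      (( trans (∣p-x∪⁅y⁆∣ a∈W v∉W) card , ∪⁅⁆-⊆ (W⊆ ∘ x∈p-y⇒x∈p W) v∈UV)
      , (v , v∈U , y∈p∪⁅y⁆) , (b , b∈V , x∈p⇒x∈p∪q (x∈p∧x≢y⇒x∈p-y b∈W b≢a)))
    exch : Exchange (Join U V (2 + d) C D) v
    exch W (inj₁ (complete , (a , a∈U , a∈W) , (b , b∈V , b∈W))) v∉W =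
      replace complete v∉W a∈W b∈V b∈W λ { refl → disjoint⁻ dis a∈U b∈V }
    exch W (inj₂ (inj₁ CW)) v∉W =
      let x , x∈W , CW′ = exchC W CW v∉W in x , x∈W , inj₂ (inj₁ CW′)
    -- Here `W` lies in `V` and has at least two elements: `a` makes room for `v`, and `b` keeps the
    -- new set in touch with `V`. This is where rank at least 2 enters.
    exch W (inj₂ (inj₂ DW)) v∉W with VS-bounded vsV DW
    ... | card , W⊆V with ∣p∣≡1+k⇒Nonempty card
    ...   | a , a∈W with ∣p∣≡1+k⇒Nonempty (∣p-y∣≡ a∈W card)
    ...     | b , b∈W-a = replace (card , x∈q⇒x∈p∪q ∘ W⊆V) v∉W a∈W
      (W⊆V b∈W) b∈W (x∈p-y⇒x≢y W b∈W-a)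
      where b∈W = x∈p-y⇒x∈p W b∈W-a

-- Gaps: induced matchings with two circuits.

record Gap (C : Clutter n) (A B : Subset n) : Set where
  field
    A∈C     : C A
    B∈C     : C B
    apart   : Disjoint A B
    induced : ∀ W → C W → W ⊆ A ∪ B → W ≡ A ⊎ W ≡ B

Gap-sym : ∀ {C : Clutter n} {A B} → Gap C A B → Gap C B A
Gap-sym {A = A} {B} g = record
  { A∈C = B∈C ; B∈C = A∈C ; apart = Disjoint-sym {p = A} {q = B} apart
  ; induced = λ W CW W⊆ → Sum.swap (induced W CW (∪-⊆ x∈q⇒x∈p∪q x∈p⇒x∈p∪q ∘ W⊆)) }
  where open Gap g

GapFree⇒¬Gap : ∀ {G : Graph n} {r A B} → GapFree r G → ¬ Gap (Con r G) A B
GapFree⇒¬Gap {A = A} {B} free g with free (A ∷ B ∷ [])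
  ( A∈C ∷ B∈C ∷ [] , (apart ∷ []) ∷ [] ∷ []
  , λ W CW W⊆ → Sum.[ Any.here , there ∘ Any.here ]′
      (induced W CW (∪-⊆ x∈p⇒x∈p∪q (∪-⊆ x∈q⇒x∈p∪q (⊥-elim ∘ ∉⊥)) ∘ W⊆)) )
  where open Gap g
... | s≤s ()

-- The first two members of a longer induced matching form a gap: a circuit inside `A ∪ B` is
-- nonempty, as the rank is positive, so it meets `A` or `B` and cannot be a later member.
¬Gap⇒GapFree : ∀ {G : Graph n} {r} → (∀ A B → ¬ Gap (Con (suc r) G) A B) → GapFree (suc r) G
¬Gap⇒GapFree noGap [] _ = z≤n
¬Gap⇒GapFree noGap (_ ∷ []) _ = s≤s z≤n
¬Gap⇒GapFree {G = G} {r} noGap (A ∷ B ∷ M) (CA ∷ CB ∷ _ , (A#B ∷ A#M) ∷ (B#M ∷ _) , induced) =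
  ⊥-elim (noGap A B record { A∈C = CA ; B∈C = CB ; apart = A#B ; induced = only })
  where
  only : ∀ W → Con (suc r) G W → W ⊆ A ∪ B → W ≡ A ⊎ W ≡ B
  only W CW W⊆ with induced W CW (∪-⊆ x∈p⇒x∈p∪q (x∈q⇒x∈p∪q ∘ x∈p⇒x∈p∪q) ∘ W⊆)
  ... | here eq = inj₁ eq
  ... | there (here eq) = inj₂ eq
  ... | there (there W∈M) with ∣p∣≡1+k⇒Nonempty (proj₁ CW)
  ...   | x , x∈W with x∈p∪q⁻ A B (W⊆ x∈W)
  ...     | inj₁ x∈A = ⊥-elim (disjoint⁻ (All.lookup A#M W∈M) x∈A x∈W)
  ...     | inj₂ x∈B = ⊥-elim (disjoint⁻ (All.lookup B#M W∈M) x∈B x∈W)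

-- Cographs

-- All vertex sets live in one fixed graph, so clutters from different nodes can be compared;
-- `IsCograph` changes the vertex type at each step.
data Cotree {n} (G : Graph n) : Subset n → Set where
  leaf : ∀ v → Cotree G ⁅ v ⁆
  node : ∀ b {U V} → Cotree G U → Cotree G V → Disjoint U V →
         (∀ {x y} → x ∈ U → y ∈ V → adj G x y ≡ b) → Cotree G (U ∪ V)

-- Quantifying over all induced embeddings lets the induction along `IsCograph` go through: at a
-- union or join the embedding restricts to the two halves, at an isomorphism it is composed.
HasCotree : ∀ {m} → Graph n → Graph m → Set
HasCotree {n} {m} G H =
  ∀ (f : Fin m → Fin n) → Injective _≡_ _≡_ f → (∀ i j → adj G (f i) (f j) ≡ adj H i j) →
  ∃[ U ] (Cotree G U × (∀ x → x ∈ U ⇔ (∃[ i ] f i ≡ x)))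

comb-cotree : ∀ b {m k} {G : Graph n} {H : Graph m} {K : Graph k} →
              HasCotree G H → HasCotree G K → HasCotree G (comb b H K)
comb-cotree b {m} {k} {G} {H} {K} tH tK f inj pres
  with tH (f ∘ (_↑ˡ k)) (Finₚ.↑ˡ-injective k _ _ ∘ inj) presˡ
     | tK (f ∘ (m ↑ʳ_)) (Finₚ.↑ʳ-injective m _ _ ∘ inj) presʳ
  where
  presˡ : ∀ i j → adj G (f (i ↑ˡ k)) (f (j ↑ˡ k)) ≡ adj H i j
  presˡ i j = trans (pres _ _)
    (≡.cong₂ (combAdj b H K) (Finₚ.splitAt-↑ˡ m i k) (Finₚ.splitAt-↑ˡ m j k))
  presʳ : ∀ i j → adj G (f (m ↑ʳ i)) (f (m ↑ʳ j)) ≡ adj K i j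
  presʳ i j = trans (pres _ _)
    (≡.cong₂ (combAdj b H K) (Finₚ.splitAt-↑ʳ m k i) (Finₚ.splitAt-↑ʳ m k j))
... | U , tU , imU | V , tV , imV =
  U ∪ V , node b tU tV (disjoint apart) cross , λ x → mk⇔ (to′ x) (from′ x)
  where
  apart : ∀ {x} → x ∈ U → x ∉ V
  apart x∈U x∈V with to (imU _) x∈U | to (imV _) x∈V
  ... | i , refl | j , eq with trans (≡.sym (Finₚ.splitAt-↑ʳ m k j))
                              (trans (cong (splitAt m) (inj eq)) (Finₚ.splitAt-↑ˡ m i k))
  ...   | ()
  cross : ∀ {x y} → x ∈ U → y ∈ V → adj G x y ≡ b
  cross x∈U y∈V with to (imU _) x∈U | to (imV _) y∈V
  ... | i , refl | j , refl = trans (pres _ _)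
    (≡.cong₂ (combAdj b H K) (Finₚ.splitAt-↑ˡ m i k) (Finₚ.splitAt-↑ʳ m k j))
  to′ : ∀ x → x ∈ U ∪ V → ∃[ i ] f i ≡ x
  to′ x x∈ with x∈p∪q⁻ U V x∈
  ... | inj₁ x∈U = let i , eq = to (imU x) x∈U in i ↑ˡ k , eq
  ... | inj₂ x∈V = let i , eq = to (imV x) x∈V in m ↑ʳ i , eq
  from′ : ∀ x → ∃[ i ] f i ≡ x → x ∈ U ∪ V
  from′ x (i , refl) with splitAt m i in eq
  ... | inj₁ j = x∈p⇒x∈p∪q (from (imU _) (j , cong f (Finₚ.splitAt⁻¹-↑ˡ eq)))
  ... | inj₂ j = x∈q⇒x∈p∪q (from (imV _) (j , cong f (Finₚ.splitAt⁻¹-↑ʳ eq)))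

cotree : ∀ {m} {G : Graph n} {H : Graph m} → IsCograph H → HasCotree G H
cotree single f _ _ = ⁅ f zero ⁆ , leaf (f zero) , λ x → mk⇔
  (λ x∈ → zero , ≡.sym (x∈⁅y⁆⇒x≡y _ x∈)) λ { (zero , refl) → x∈⁅x⁆ _ }
cotree (union cG cH) = comb-cotree false (cotree cG) (cotree cH)
cotree (join cG cH) = comb-cotree true (cotree cG) (cotree cH)
cotree (iso g pres′ cG) f inj pres
  with cotree cG (f ∘ Bijection.to g) (Bijection.injective g ∘ inj)
                 (λ i j → trans (pres _ _) (pres′ i j))
... | U , t , im = U , t , λ x → mk⇔
  (λ x∈ → let i , eq = to (im x) x∈ in Bijection.to g i , eq)
  (λ { (i , refl) → let j , eq = Bijection.surjective g i in from (im _) (j , cong f (eq refl)) })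

cograph-cotree : ∀ {G : Graph n} → IsCograph G → Cotree G ⊤
cograph-cotree {G = G} cG with cotree cG id id (λ _ _ → refl)
... | U , t , im = subst (Cotree G) (⊆-antisym ⊆⊤ (λ {x} _ → from (im x) (x , refl))) t

ConIn : ℕ → Graph n → Subset n → Clutter n
ConIn r G U W = Con r G W × W ⊆ U

path-start : ∀ {G : Graph n} {W x y} → Path G W x y → x ∈ W
path-start (Path.here x∈) = x∈
path-start (step x∈ _ _) = x∈

module _ {G : Graph n} {U V : Subset n} where

  union-path : (∀ {x y} → x ∈ U → y ∈ V → adj G x y ≡ false) →
               ∀ {W x y} → W ⊆ U ∪ V → Path G W x y → x ∈ U → y ∈ U
  union-path non W⊆ (Path.here _) x∈U = x∈U
  union-path non W⊆ (step _ e p) x∈U with x∈p∪q⁻ U V (W⊆ (path-start p))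
  ... | inj₁ y∈U = union-path non W⊆ p y∈U
  ... | inj₂ y∈V with trans (≡.sym e) (non x∈U y∈V)
  ...   | ()

-- Vertices on different sides are adjacent; two on the same side are linked through a vertex of `W`
-- on the other.
join-connected : ∀ {G : Graph n} {U V} → (∀ {x y} → x ∈ U → y ∈ V → adj G x y ≡ true) →
                 ∀ {W} → W ⊆ U ∪ V → Meets U W → Meets V W → InducedConnected G W
join-connected {G = G} {U} {V} adjacent {W} W⊆ (a , a∈U , a∈W) (b , b∈V , b∈W) x y x∈W y∈W
  with x∈p∪q⁻ U V (W⊆ x∈W) | x∈p∪q⁻ U V (W⊆ y∈W)
... | inj₁ x∈U | inj₁ y∈U = step x∈W (adjacent x∈U b∈V)
  (step b∈W (trans (Graph.sym G _ _) (adjacent y∈U b∈V)) (Path.here y∈W))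
... | inj₁ x∈U | inj₂ y∈V = step x∈W (adjacent x∈U y∈V) (Path.here y∈W)
... | inj₂ x∈V | inj₁ y∈U = step x∈W (trans (Graph.sym G _ _) (adjacent y∈U x∈V)) (Path.here y∈W)
... | inj₂ x∈V | inj₂ y∈V = step x∈W (trans (Graph.sym G _ _) (adjacent a∈U x∈V))
  (step a∈W (adjacent a∈U y∈V) (Path.here y∈W))

-- The side of a single vertex of `W` decides, since no path crosses between the sides.
union-splits : ∀ {G : Graph n} {U V r W} → (∀ {x y} → x ∈ U → y ∈ V → adj G x y ≡ false) →
               Con (suc r) G W → W ⊆ U ∪ V → W ⊆ U ⊎ W ⊆ V
union-splits {G = G} {U} {V} {W = W} non (card , conn) W⊆ with ∣p∣≡1+k⇒Nonempty card
... | x , x∈W with x∈p∪q⁻ U V (W⊆ x∈W)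
...   | inj₁ x∈U = inj₁ λ y∈W → union-path {G = G} non W⊆ (conn _ _ x∈W y∈W) x∈U
...   | inj₂ x∈V = inj₂ λ y∈W → union-path {G = G} non′
          (∪-⊆ x∈q⇒x∈p∪q x∈p⇒x∈p∪q ∘ W⊆) (conn _ _ x∈W y∈W) x∈V
  where
  non′ : ∀ {x y} → x ∈ V → y ∈ U → adj G x y ≡ false
  non′ x∈V y∈U = trans (Graph.sym G _ _) (non y∈U x∈V)

⊆-resolve : ∀ {p q s : Subset n} → p ⊆ q ⊎ p ⊆ s → ¬ p ⊆ q → p ⊆ s
⊆-resolve (inj₁ p⊆q) p⊈q = ⊥-elim (p⊈q p⊆q)
⊆-resolve (inj₂ p⊆s) _ = p⊆s

-- A circuit in `A ∪ B` stays on one side, hence inside `A` or inside `B`, and equal sizes force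
-- equality.
union-gap : ∀ {G : Graph n} {U V r A B} → Disjoint U V →
            (∀ {x y} → x ∈ U → y ∈ V → adj G x y ≡ false) →
            ConIn (suc r) G U A → ConIn (suc r) G V B → Gap (Con (suc r) G) A B
union-gap {G = G} {U} {V} {r} {A} {B} dis non (CA , A⊆U) (CB , B⊆V) = record
  { A∈C = CA ; B∈C = CB ; apart = disjoint λ x∈A → disjoint⁻ dis (A⊆U x∈A) ∘ B⊆V
  ; induced = only }
  where
  A∪B⊆U∪V : A ∪ B ⊆ U ∪ V
  A∪B⊆U∪V = ∪-⊆ (x∈p⇒x∈p∪q ∘ A⊆U) (x∈q⇒x∈p∪q ∘ B⊆V)
  only : ∀ W → Con (suc r) G W → W ⊆ A ∪ B → W ≡ A ⊎ W ≡ B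
  only W CW W⊆ with union-splits {G = G} non CW (A∪B⊆U∪V ∘ W⊆)
  ... | inj₁ W⊆U = inj₁ (p⊆q∧∣q∣≤∣p∣⇒p≡q
    (λ x∈W → Sum.[ id , ⊥-elim ∘ disjoint⁻ dis (W⊆U x∈W) ∘ B⊆V ] (x∈p∪q⁻ A B (W⊆ x∈W)))
    (ℕₚ.≤-reflexive (trans (proj₁ CA) (≡.sym (proj₁ CW)))))
  ... | inj₂ W⊆V = inj₂ (p⊆q∧∣q∣≤∣p∣⇒p≡q
    (λ x∈W → Sum.[ (λ x∈A → ⊥-elim (disjoint⁻ dis (A⊆U x∈A) (W⊆V x∈W))) , id ]
                 (x∈p∪q⁻ A B (W⊆ x∈W)))
    (ℕₚ.≤-reflexive (trans (proj₁ CB) (≡.sym (proj₁ CW)))))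

module _ {G : Graph n} {d : ℕ} (gapFree : GapFree (2 + d) G) where

  -- At a union the induction hypotheses also decide, through `VS-inhabited?`, which side has
  -- circuits. Gap-freeness excludes both, so the clutter is that of one side.
  cotree-VS : ∀ {U} → Cotree G U → VertexSplittable U (2 + d) (ConIn (2 + d) G U)
  cotree-VS (leaf v) = VS-void λ { W ((card , _) , W⊆) →
    ℕₚ.<⇒≱ (s≤s (s≤s z≤n)) (≡.subst₂ _≤_ card (∣⁅x⁆∣≡1 v) (p⊆q⇒∣p∣≤∣q∣ W⊆)) }
  cotree-VS (node true {U} {V} tU tV dis adjacent) =
    VS-mono (VS-join dis (cotree-VS tU) (cotree-VS tV)) id λ W → mk⇔ (λ
      { (inj₁ ((card , W⊆) , mU , mV)) → (card , join-connected {G = G} adjacent W⊆ mU mV) , W⊆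
      ; (inj₂ (inj₁ (CW , W⊆))) → CW , x∈p⇒x∈p∪q ∘ W⊆
      ; (inj₂ (inj₂ (CW , W⊆))) → CW , x∈q⇒x∈p∪q ∘ W⊆ })
    (classify W)
    where
    classify : ∀ W → ConIn (2 + d) G (U ∪ V) W →
               Join U V (2 + d) (ConIn (2 + d) G U) (ConIn (2 + d) G V) W
    classify W (CW , W⊆) with nonempty? (U ∩ W) | nonempty? (V ∩ W)
    ... | yes (x , x∈) | yes (y , y∈) =
      inj₁ ((proj₁ CW , W⊆) , (x , x∈p∩q⁻ U W x∈) , (y , x∈p∩q⁻ V W y∈))
    ... | no U#W | _ = inj₂ (inj₂ (CW ,
      meets-⊆ (∪-⊆ x∈q⇒x∈p∪q x∈p⇒x∈p∪q ∘ W⊆) (disjoint⁻ U#W)))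
    ... | yes _ | no V#W = inj₂ (inj₁ (CW , meets-⊆ W⊆ (disjoint⁻ V#W)))
  cotree-VS (node false {U} {V} tU tV dis non)
    with VS-inhabited? (cotree-VS tU) | VS-inhabited? (cotree-VS tV)
  ... | inj₁ (A , CA) | inj₁ (B , CB) =
    ⊥-elim (GapFree⇒¬Gap {G = G} gapFree (union-gap {G = G} dis non CA CB))
  ... | inj₂ noU | _ = VS-mono (cotree-VS tV) x∈q⇒x∈p∪q λ W → mk⇔
    (λ { (CW , W⊆) → CW , x∈q⇒x∈p∪q ∘ W⊆ })
    (λ { (CW , W⊆) → CW , ⊆-resolve (union-splits {G = G} non CW W⊆) λ W⊆U → noU W (CW , W⊆U) })
  ... | inj₁ _ | inj₂ noV = VS-mono (cotree-VS tU) x∈p⇒x∈p∪q λ W → mk⇔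
    (λ { (CW , W⊆) → CW , x∈p⇒x∈p∪q ∘ W⊆ })
    (λ { (CW , W⊆) → CW , ⊆-resolve (Sum.swap (union-splits {G = G} non CW W⊆)) λ W⊆V → noV W (CW , W⊆V) })

cograph-VS : ∀ {G : Graph n} {d} → IsCograph G → GapFree (2 + d) G →
             VertexSplittable ⊤ (2 + d) (Con (2 + d) G)
cograph-VS {G = G} {d} cG gapFree =
  VS-mono (cotree-VS gapFree (cograph-cotree cG)) id λ W → mk⇔ proj₁ (inside W)
  where
  inside : ∀ W → Con (2 + d) G W → ConIn (2 + d) G ⊤ W
  inside W CW = CW , ⊆⊤

-- Vertex decomposability

-- For circuits inside `U`, this is the Alexander dual, relative to `U`, of the complex of subsets
-- of `U` that contain no circuit.
ComplementComplex : Subset n → Clutter n → Complex n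
ComplementComplex U C F = F ⊆ U × ∃[ W ] (C W × Disjoint F W)

module _ {U : Subset n} {C : Clutter n} {v : Fin n} where

  complex-contraction⁻ : ∀ {F} → v ∈ U → ComplementComplex (U - v) (contraction C v) F →
                         ComplementComplex U C F × v ∉ F
  complex-contraction⁻ {F} v∈U (F⊆ , W , (v∉W , CW) , dis) =
    (x∈p-y⇒x∈p U ∘ F⊆ , W ∪ ⁅ v ⁆ , CW , disjoint λ x∈F x∈W →
      disjoint⁻ dis x∈F (x∈p∪⁅y⁆∧x≢y⇒x∈p W x∈W λ { refl → x∉p-x U v (F⊆ x∈F) }))
    , x∉p-x U v ∘ F⊆

  complex-contraction⁺ : ∀ {F W} → F ⊆ U → v ∉ F → C W → v ∈ W → Disjoint F W →
                         ComplementComplex (U - v) (contraction C v) F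
  complex-contraction⁺ {W = W} F⊆ v∉F CW v∈W dis = p⊆q-y F⊆ v∉F , W - v ,
    contraction-∋ {C = C} CW v∈W , disjoint (λ x∈F → disjoint⁻ dis x∈F ∘ x∈p-y⇒x∈p W)

  -- A face without `v` misses some circuit through `v`: trade an element for `v`, which is outside
  -- the face anyway. So deletion of the vertex corresponds to contraction of the clutter.
  complex-exchange : ∀ {F} → Exchange C v → ComplementComplex U C F → v ∉ F →
                     ComplementComplex (U - v) (contraction C v) F
  complex-exchange {F} exch (F⊆ , W , CW , dis) v∉F with v ∈? W
  ... | yes v∈W = complex-contraction⁺ F⊆ v∉F CW v∈W dis
  ... | no v∉W with exch W CW v∉W
  ...   | x , x∈W , CW′ = complex-contraction⁺ F⊆ v∉F CW′ y∈p∪⁅y⁆ (disjoint λ y∈F y∈ →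
            Sum.[ disjoint⁻ dis y∈F ∘ x∈p-y⇒x∈p W , (λ { refl → v∉F y∈F }) ]′ (x∈p∪⁅y⁆⁻ (W - x) y∈))

  -- A circuit missed by `F ∪ ⁅ v ⁆` avoids `v`, so the link corresponds to deletion in the clutter.
  complex-deletion : ∀ {F} → v ∈ U → v ∉ F →
    ComplementComplex U C (F ∪ ⁅ v ⁆) ⇔ ComplementComplex (U - v) (deletion C v) F
  complex-deletion {F} v∈U v∉F = mk⇔
    (λ { (F⊆ , W , CW , dis) → p⊆q-y (F⊆ ∘ x∈p⇒x∈p∪q) v∉F , W , (CW , disjoint⁻ dis y∈p∪⁅y⁆)
                             , disjoint (disjoint⁻ dis ∘ x∈p⇒x∈p∪q) })
    (λ { (F⊆ , W , (CW , v∉W) , dis) → ∪⁅⁆-⊆ (x∈p-y⇒x∈p U ∘ F⊆) v∈U , W , CW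
                             , disjoint λ x∈ → Sum.[ disjoint⁻ dis , (λ { refl → v∉W }) ]′ (x∈p∪⁅y⁆⁻ F x∈) })

-- `Δ` is given up to equivalence of faces, because links and deletions match the complexes of the
-- smaller clutters only in that sense.
VS⇒VertexDecomposable : ∀ {U : Subset n} {d C Δ} → VertexSplittable U d C →
  (∀ F → Δ F ⇔ ComplementComplex U C F) → VertexDecomposable Δ
VS⇒VertexDecomposable {U = U} {Δ = Δ} (rank0 (yes C⊥) _) eq = simplex U λ F → mk⇔ (face F)
  λ F⊆U → from (eq F) (F⊆U , ⊥ , C⊥ , disjoint λ _ → ∉⊥)
  where
  face : ∀ F → Δ F → F ⊆ U
  face F ΔF = proj₁ (to (eq F) ΔF)
VS⇒VertexDecomposable {C = C} (rank0 (no ¬C⊥) only) eq = void λ F ΔF →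
  let _ , W , CW , _ = to (eq F) ΔF in ¬C⊥ (subst C (only W CW) CW)
VS⇒VertexDecomposable (empty _ none) eq = void λ F ΔF →
  let _ , W , CW , _ = to (eq F) ΔF in none W CW
VS⇒VertexDecomposable {U = U} {C = C} {Δ} (split v v∈U exch vsD vsC) eq with VS-inhabited? vsD
-- Every circuit contains `v`, so `v` is not a vertex of `Δ` and cannot be shed; `Δ` is already the
-- complex of the contraction.
... | inj₂ none = VS⇒VertexDecomposable vsC λ F → mk⇔
  (λ ΔF → let F⊆ , W , CW , dis = to (eq F) ΔF
              v∈W = contains-v W CW
          in complex-contraction⁺ {C = C} F⊆ (λ v∈F → disjoint⁻ dis v∈F v∈W) CW v∈W dis)
  (from (eq F) ∘ proj₁ ∘ complex-contraction⁻ v∈U)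
  where
  contains-v : ∀ W → C W → v ∈ W
  contains-v W CW with v ∈? W
  ... | yes v∈W = v∈W
  ... | no v∉W = ⊥-elim (none W (CW , v∉W))
... | inj₁ (W₀ , CW₀ , v∉W₀) = shedding v vertex sheds
  (VS⇒VertexDecomposable vsD λ F → mk⇔
    (λ { (v∉F , ΔF) → to (complex-deletion v∈U v∉F) (to (eq _) ΔF) })
    (λ { c@(F⊆ , _) → let v∉F = x∉p-x U v ∘ F⊆ in
           v∉F , from (eq _) (from (complex-deletion v∈U v∉F) c) }))
  (VS⇒VertexDecomposable vsC λ F → mk⇔
    (λ { (ΔF , v∉F) → complex-exchange exch (to (eq F) ΔF) v∉F })
    (Product.map₁ (from (eq F)) ∘ complex-contraction⁻ v∈U))
  where
  vertex : Δ ⁅ v ⁆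
  vertex = from (eq _) ((λ x∈ → subst (_∈ U) (≡.sym (x∈⁅y⁆⇒x≡y v x∈)) v∈U) , W₀ , CW₀ ,
    disjoint λ x∈ → subst (_∉ W₀) (≡.sym (x∈⁅y⁆⇒x≡y v x∈)) v∉W₀)
  -- If `F ∪ ⁅ v ⁆` misses `W`, then `F ∪ ⁅ x ⁆` misses `(W - x) ∪ ⁅ v ⁆`, so `F` is not maximal in
  -- the deletion.
  sheds : ∀ F → Facet (lk Δ v) F → ¬ Facet (del Δ v) F
  sheds F ((v∉F , ΔF) , _) (_ , max) with to (eq _) ΔF
  ... | F⊆ , W , CW , dis with exch W CW (disjoint⁻ dis y∈p∪⁅y⁆)
  ...   | x , x∈W , CW′ = x∉F (subst (x ∈_)
          (max (F ∪ ⁅ x ⁆) (from (eq _) (F+x⊆U , _ , CW′ , dis′) , v∉F+x) x∈p⇒x∈p∪q) y∈p∪⁅y⁆)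
    where
    x∉F : x ∉ F
    x∉F x∈F = disjoint⁻ dis (x∈p⇒x∈p∪q x∈F) x∈W
    x≢v : x ≢ v
    x≢v refl = disjoint⁻ dis y∈p∪⁅y⁆ x∈W
    v∉F+x : v ∉ F ∪ ⁅ x ⁆
    v∉F+x v∈ = v∉F (x∈p∪⁅y⁆∧x≢y⇒x∈p F v∈ (x≢v ∘ ≡.sym))
    F+x⊆U : F ∪ ⁅ x ⁆ ⊆ U
    F+x⊆U = ∪⁅⁆-⊆ (F⊆ ∘ x∈p⇒x∈p∪q) (proj₂ (VS-bounded (split v v∈U exch vsD vsC) CW) x∈W)
    dis′ : Disjoint (F ∪ ⁅ x ⁆) ((W - x) ∪ ⁅ v ⁆)
    dis′ = disjoint λ y∈ y∈W′ → Sum.[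
      (λ y∈W-x → Sum.[ (λ y∈F → disjoint⁻ dis (x∈p⇒x∈p∪q y∈F) (x∈p-y⇒x∈p W y∈W-x))
                     , x∈p-y⇒x≢y W y∈W-x ]′ (x∈p∪⁅y⁆⁻ F y∈)) ,
      (λ { refl → v∉F+x y∈ }) ]′ (x∈p∪⁅y⁆⁻ (W - x) y∈W′)

-- Disconnected links obstruct vertex decomposability.

TwoIn : Subset n → Subset n → Set
TwoIn P F = ∃[ x ] ∃[ y ] (x ∈ P × x ∉ F × y ∈ P × y ∉ F × x ≢ y)

TwoIn-avoid : ∀ {P F : Subset n} → TwoIn P F → ∀ v → ∃[ x ] (x ∈ P × x ∉ F × x ≢ v)
TwoIn-avoid (x , y , x∈P , x∉F , y∈P , y∉F , x≢y) v with x Finₚ.≟ v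
... | yes refl = y , y∈P , y∉F , x≢y ∘ ≡.sym
... | no x≢v = x , x∈P , x∉F , x≢v

-- The link of F is the disjoint union of the simplices on P ∖ F and Q ∖ F, neither of them a point.
record SplitLink {n} (Δ : Complex n) (F P Q : Subset n) : Set where
  field
    F⊆P   : F ⊆ P
    F⊆Q   : F ⊆ Q
    P∩Q⊆F : ∀ {x} → x ∈ P → x ∈ Q → x ∈ F
    faces : ∀ G → F ⊆ G → Δ G ⇔ (G ⊆ P ⊎ G ⊆ Q)
    P∖F   : TwoIn P F
    Q∖F   : TwoIn Q F

SplitLink-sym : ∀ {Δ : Complex n} {F P Q} → SplitLink Δ F P Q → SplitLink Δ F Q P
SplitLink-sym s = record
  { F⊆P = F⊆Q ; F⊆Q = F⊆P ; P∩Q⊆F = λ x∈Q x∈P → P∩Q⊆F x∈P x∈Q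
  ; faces = λ G F⊆G → mk⇔ (Sum.swap ∘ to (faces G F⊆G)) (from (faces G F⊆G) ∘ Sum.swap)
  ; P∖F = Q∖F ; Q∖F = P∖F }
  where open SplitLink s

-- The witness `P - v` is a facet of both complexes. In the deletion it is maximal because `P` has a
-- second element outside `F`, which keeps `P - v` from lying in `Q`.
SplitLink-not-shedding : ∀ {Δ : Complex n} {F P Q v} → SplitLink Δ F P Q → v ∉ F → v ∈ P →
  ¬ (∀ F → Facet (lk Δ v) F → ¬ Facet (del Δ v) F)
SplitLink-not-shedding {Δ = Δ} {F} {P} {Q} {v} s v∉F v∈P sheds = sheds (P - v)
  ((x∉p-x P v , subst Δ (≡.sym (p-y∪⁅y⁆≡p v∈P)) (from (faces P F⊆P) (inj₁ id))) , max-lk)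
  ((from (faces (P - v) F⊆P-v) (inj₁ (x∈p-y⇒x∈p P)) , x∉p-x P v) , max-del)
  where
  open SplitLink s
  F⊆P-v : F ⊆ P - v
  F⊆P-v = p⊆q-y F⊆P v∉F
  max-lk : ∀ G → lk Δ v G → P - v ⊆ G → G ≡ P - v
  max-lk G (v∉G , ΔG) P-v⊆G with to (faces _ (x∈p⇒x∈p∪q ∘ P-v⊆G ∘ F⊆P-v)) ΔG
  ... | inj₁ G+v⊆P = ⊆-antisym (p⊆q-y (G+v⊆P ∘ x∈p⇒x∈p∪q) v∉G) P-v⊆G
  ... | inj₂ G+v⊆Q = ⊥-elim (v∉F (P∩Q⊆F v∈P (G+v⊆Q y∈p∪⁅y⁆)))
  max-del : ∀ G → del Δ v G → P - v ⊆ G → G ≡ P - v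
  max-del G (ΔG , v∉G) P-v⊆G with to (faces G (P-v⊆G ∘ F⊆P-v)) ΔG
  ... | inj₁ G⊆P = ⊆-antisym (p⊆q-y G⊆P v∉G) P-v⊆G
  ... | inj₂ G⊆Q = let x , x∈P , x∉F , x≢v = TwoIn-avoid P∖F v in
    ⊥-elim (x∉F (P∩Q⊆F x∈P (G⊆Q (P-v⊆G (x∈p∧x≢y⇒x∈p-y x∈P x≢v)))))

-- Induction on the decomposition. A simplex would have the face `P ∪ Q`. A shedding vertex in `F`
-- passes the split to the link, one outside `P ∪ Q` passes it to the deletion, and any other vertex
-- fails to shed.
VertexDecomposable⇒¬SplitLink : ∀ {Δ : Complex n} {F P Q} →
  VertexDecomposable Δ → ¬ SplitLink Δ F P Q
VertexDecomposable⇒¬SplitLink {P = P} {Q} (simplex S eq) s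
  with to (faces (P ∪ Q) (x∈p⇒x∈p∪q ∘ F⊆P))
          (from (eq _) (∪-⊆ (to (eq P) (from (faces P F⊆P) (inj₁ id)))
                            (to (eq Q) (from (faces Q F⊆Q) (inj₂ id)))))
  where open SplitLink s
... | inj₁ ⊆P = let x , _ , x∈Q , x∉F , _ = Q∖F in x∉F (P∩Q⊆F (⊆P (x∈q⇒x∈p∪q x∈Q)) x∈Q)
  where open SplitLink s
... | inj₂ ⊆Q = let x , _ , x∈P , x∉F , _ = P∖F in x∉F (P∩Q⊆F x∈P (⊆Q (x∈p⇒x∈p∪q x∈P)))
  where open SplitLink s
VertexDecomposable⇒¬SplitLink (void none) s = none _ (from (faces _ F⊆P) (inj₁ id))
  where open SplitLink s
VertexDecomposable⇒¬SplitLink {Δ = Δ} {F} {P} {Q} (shedding v _ sheds vdL vdD) s with v ∈? F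
... | yes v∈F = VertexDecomposable⇒¬SplitLink {F = F - v} {P - v} {Q - v} vdL record
  { F⊆P = -⊆-mono F⊆P ; F⊆Q = -⊆-mono F⊆Q
  ; P∩Q⊆F = λ x∈P x∈Q →
      x∈p∧x≢y⇒x∈p-y (P∩Q⊆F (x∈p-y⇒x∈p P x∈P) (x∈p-y⇒x∈p Q x∈Q)) (x∈p-y⇒x≢y P x∈P)
  ; faces = λ G F-v⊆G → mk⇔
      (λ { (v∉G , ΔG) → drop-v v∉G (to (faces _ (F⊆G+v F-v⊆G)) ΔG) })
      λ { (inj₁ G⊆) → x∉p-x P v ∘ G⊆ ,
            from (faces _ (F⊆G+v F-v⊆G)) (inj₁ (∪⁅⁆-⊆ (x∈p-y⇒x∈p P ∘ G⊆) (F⊆P v∈F)))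
        ; (inj₂ G⊆) → x∉p-x Q v ∘ G⊆ ,
            from (faces _ (F⊆G+v F-v⊆G)) (inj₂ (∪⁅⁆-⊆ (x∈p-y⇒x∈p Q ∘ G⊆) (F⊆Q v∈F))) }
  ; P∖F = shrink P∖F ; Q∖F = shrink Q∖F }
  where
  open SplitLink s
  F⊆G+v : ∀ {G} → F - v ⊆ G → F ⊆ G ∪ ⁅ v ⁆
  F⊆G+v F-v⊆G = ∪-monoˡ-⊆ F-v⊆G ∘ p⊆p-y∪⁅y⁆ F v
  drop-v : ∀ {G} → v ∉ G → G ∪ ⁅ v ⁆ ⊆ P ⊎ G ∪ ⁅ v ⁆ ⊆ Q → G ⊆ P - v ⊎ G ⊆ Q - v
  drop-v v∉G (inj₁ ⊆P) = inj₁ (p⊆q-y (⊆P ∘ x∈p⇒x∈p∪q) v∉G)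
  drop-v v∉G (inj₂ ⊆Q) = inj₂ (p⊆q-y (⊆Q ∘ x∈p⇒x∈p∪q) v∉G)
  shrink : ∀ {R} → TwoIn R F → TwoIn (R - v) (F - v)
  shrink {R} (x , y , x∈R , x∉F , y∈R , y∉F , x≢y) =
    x , y , x∈p∧x≢y⇒x∈p-y x∈R (λ { refl → x∉F v∈F }) , x∉F ∘ x∈p-y⇒x∈p F
          , x∈p∧x≢y⇒x∈p-y y∈R (λ { refl → y∉F v∈F }) , y∉F ∘ x∈p-y⇒x∈p F , x≢y
... | no v∉F with v ∈? P | v ∈? Q
...   | yes v∈P | _ = SplitLink-not-shedding s v∉F v∈P sheds
...   | no _ | yes v∈Q = SplitLink-not-shedding (SplitLink-sym s) v∉F v∈Q sheds
...   | no v∉P | no v∉Q = VertexDecomposable⇒¬SplitLink vdD record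
  { F⊆P = F⊆P ; F⊆Q = F⊆Q ; P∩Q⊆F = P∩Q⊆F ; P∖F = P∖F ; Q∖F = Q∖F
  ; faces = λ G F⊆G → mk⇔ (to (faces G F⊆G) ∘ proj₁)
      λ { (inj₁ G⊆P) → from (faces G F⊆G) (inj₁ G⊆P) , v∉P ∘ G⊆P
        ; (inj₂ G⊆Q) → from (faces G F⊆G) (inj₂ G⊆Q) , v∉Q ∘ G⊆Q } }
  where open SplitLink s

two-elements : ∀ {p : Subset n} {k} → ∣ p ∣ ≡ 2 + k → ∃[ x ] ∃[ y ] (x ∈ p × y ∈ p × x ≢ y)
two-elements {p = p} card with ∣p∣≡1+k⇒Nonempty card
... | y , y∈p with ∣p∣≡1+k⇒Nonempty (∣p-y∣≡ y∈p card)
...   | x , x∈ = x , y , x∈p-y⇒x∈p p x∈ , y∈p , x∈p-y⇒x≢y p x∈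

-- `Σr r G` is `Γ (Con r G)` by definition.
Γ : Clutter n → Complex n
Γ C F = ∃[ W ] (C W × Disjoint F W)

disjoint⇒⊆∁ : ∀ {F W : Subset n} → Disjoint F W → F ⊆ ∁ W
disjoint⇒⊆∁ dis x∈F = x∉p⇒x∈∁p (disjoint⁻ dis x∈F)

⊆∁⇒disjoint : ∀ {F W : Subset n} → F ⊆ ∁ W → Disjoint F W
⊆∁⇒disjoint F⊆ = disjoint (x∈∁p⇒x∉p ∘ F⊆)

within-union : ∀ {p G W : Subset n} → ∁ p ⊆ G → Disjoint G W → W ⊆ p
within-union ∁p⊆G dis = ∁p⊆∁q⇒p⊇q (disjoint⇒⊆∁ dis ∘ ∁p⊆G)

-- A circuit missed by a face above `∁ (A ∪ B)` lies in `A ∪ B`, so it is `A` or `B`.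
∁∪-faces : ∀ {C : Clutter n} {A B} → Gap C A B → ∀ G → ∁ (A ∪ B) ⊆ G →
           Γ C G ⇔ (G ⊆ ∁ A ⊎ G ⊆ ∁ B)
∁∪-faces {C = C} {A} {B} g G F⊆G = mk⇔ ⇒ λ
  { (inj₁ G⊆) → A , A∈C , ⊆∁⇒disjoint G⊆
  ; (inj₂ G⊆) → B , B∈C , ⊆∁⇒disjoint G⊆ }
  where
  open Gap g
  ⇒ : Γ C G → G ⊆ ∁ A ⊎ G ⊆ ∁ B
  ⇒ (W , CW , dis) with induced W CW (within-union F⊆G dis)
  ... | inj₁ refl = inj₁ (disjoint⇒⊆∁ dis)
  ... | inj₂ refl = inj₂ (disjoint⇒⊆∁ dis)

Gap⇒SplitLink : ∀ {C : Clutter n} {A B k l} → ∣ A ∣ ≡ 2 + k → ∣ B ∣ ≡ 2 + l → Gap C A B →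
                SplitLink (Γ C) (∁ (A ∪ B)) (∁ A) (∁ B)
Gap⇒SplitLink {C = C} {A} {B} cardA cardB g = record
  { F⊆P = p⊆q⇒∁p⊇∁q x∈p⇒x∈p∪q ; F⊆Q = p⊆q⇒∁p⊇∁q x∈q⇒x∈p∪q
  ; P∩Q⊆F = λ x∈∁A x∈∁B → x∉p⇒x∈∁p (Sum.[ x∈∁p⇒x∉p x∈∁A , x∈∁p⇒x∉p x∈∁B ]′ ∘ x∈p∪q⁻ A B)
  ; faces = ∁∪-faces g
  ; P∖F = let x , y , x∈B , y∈B , x≢y = two-elements cardB in
      x , y , x∉p⇒x∈∁p (λ x∈A → disjoint⁻ apart x∈A x∈B) , x∈p⇒x∉∁p (x∈q⇒x∈p∪q x∈B)
            , x∉p⇒x∈∁p (λ y∈A → disjoint⁻ apart y∈A y∈B) , x∈p⇒x∉∁p (x∈q⇒x∈p∪q y∈B) , x≢y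
  ; Q∖F = let x , y , x∈A , y∈A , x≢y = two-elements cardA in
      x , y , x∉p⇒x∈∁p (disjoint⁻ apart x∈A) , x∈p⇒x∉∁p (x∈p⇒x∈p∪q x∈A)
            , x∉p⇒x∈∁p (disjoint⁻ apart y∈A) , x∈p⇒x∉∁p (x∈p⇒x∈p∪q y∈A) , x≢y }
  where open Gap g

-- Shellability

-- Linear quotients are stated for the circuits; the facets of the shelling are their complements.
Covers : Clutter n → Subset n → Set
Covers P w = ∀ u → P u → ∃[ k ] (P k × ∃[ x ] (x ∈ u × x ∉ w × k ⊆ w ∪ ⁅ x ⁆))

-- `P` holds the circuits listed earlier, so that lists can be concatenated.
data LinearQuotients {n} (P : Clutter n) : List (Subset n) → Set₁ where
  []  : LinearQuotients P []
  _∷_ : ∀ {w ws} → Covers P w → LinearQuotients (λ u → P u ⊎ u ≡ w) ws → LinearQuotients P (w ∷ ws)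

LQ-resp : ∀ {P Q : Clutter n} {L} → (∀ u → P u ⇔ Q u) → LinearQuotients P L → LinearQuotients Q L
LQ-resp eq [] = []
LQ-resp eq (c ∷ lq) =
  (λ u Qu → let k , Pk , rest = c u (from (eq u) Qu) in k , to (eq k) Pk , rest) ∷
  LQ-resp (λ u → mk⇔ (Sum.map₁ (to (eq u))) (Sum.map₁ (from (eq u)))) lq

LQ-++ : ∀ {P : Clutter n} {L L′} → LinearQuotients P L →
        LinearQuotients (λ u → P u ⊎ u ∈ₗ L) L′ → LinearQuotients P (L List.++ L′)
LQ-++ [] lq′ = LQ-resp (λ u → mk⇔ (λ { (inj₁ Pu) → Pu ; (inj₂ ()) }) inj₁) lq′
LQ-++ (c ∷ lq) lq′ = c ∷ LQ-++ lq (LQ-resp (λ u → mk⇔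
  (λ { (inj₁ Pu) → inj₁ (inj₁ Pu) ; (inj₂ (here eq)) → inj₁ (inj₂ eq) ; (inj₂ (there u∈)) → inj₂ u∈ })
  (λ { (inj₁ (inj₁ Pu)) → inj₁ Pu ; (inj₁ (inj₂ eq)) → inj₂ (here eq) ; (inj₂ u∈) → inj₂ (there u∈) }))
  lq′)

LQ-merge : ∀ {P Q : Clutter n} {L} → (∀ {w} → w ∈ₗ L → Covers Q w) → LinearQuotients P L →
           LinearQuotients (λ u → Q u ⊎ P u) L
LQ-merge cov [] = []
LQ-merge cov (c ∷ lq) =
  (λ { u (inj₁ Qu) → Product.map₂ (Product.map₁ inj₁) (cov (here refl) u Qu)
     ; u (inj₂ Pu) → Product.map₂ (Product.map₁ inj₂) (c u Pu) }) ∷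
  LQ-resp (λ u → mk⇔ Sum.assocˡ Sum.assocʳ) (LQ-merge (cov ∘ there) lq)

LQ-cone : ∀ {P : Clutter n} {L v} → (∀ u → P u → v ∉ u) → All (v ∉_) L → LinearQuotients P L →
          LinearQuotients (λ u → ∃[ u′ ] (P u′ × u ≡ u′ ∪ ⁅ v ⁆)) (List.map (_∪ ⁅ v ⁆) L)
LQ-cone _ _ [] = []
LQ-cone {P = P} {v = v} v∉P (v∉w ∷ v∉ws) (_∷_ {w} c lq) = c′ ∷ LQ-resp (λ u → mk⇔
  (λ { (u′ , inj₁ Pu′ , eq) → inj₁ (u′ , Pu′ , eq) ; (u′ , inj₂ refl , eq) → inj₂ eq })
  (λ { (inj₁ (u′ , Pu′ , eq)) → u′ , inj₁ Pu′ , eq ; (inj₂ eq) → _ , inj₂ refl , eq }))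
  (LQ-cone (λ { u (inj₁ Pu) → v∉P u Pu ; u (inj₂ refl) → v∉w }) v∉ws lq)
  where
  c′ : Covers (λ u → ∃[ u′ ] (P u′ × u ≡ u′ ∪ ⁅ v ⁆)) (w ∪ ⁅ v ⁆)
  c′ _ (u , Pu , refl) with c u Pu
  ... | k , Pk , x , x∈u , x∉w , k⊆ = k ∪ ⁅ v ⁆ , (k , Pk , refl) , x , x∈p⇒x∈p∪q x∈u
    , (λ x∈ → Sum.[ x∉w , (λ { refl → v∉P u Pu x∈u }) ]′ (x∈p∪⁅y⁆⁻ w x∈))
    , ∪⁅⁆-⊆ (∪-monoˡ-⊆ x∈p⇒x∈p∪q ∘ k⊆) (x∈p⇒x∈p∪q y∈p∪⁅y⁆)

-- List the circuits through `v` first, then those of the deletion. For `w` in the deletion the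
-- exchange gives an earlier `(w - x) ∪ ⁅ v ⁆`, and the new element is `v` itself, which lies in
-- every circuit of the first block.
VS⇒LinearQuotients : ∀ {U : Subset n} {d C} → VertexSplittable U d C →
  ∃[ L ] (Unique L × (∀ W → C W ⇔ W ∈ₗ L) × LinearQuotients (λ _ → Empty.⊥) L)
VS⇒LinearQuotients (rank0 (yes C⊥) only) = ⊥ ∷ [] , [] ∷ [] ,
  (λ W → mk⇔ (here ∘ only W) λ { (here refl) → C⊥ }) , (λ _ ()) ∷ []
VS⇒LinearQuotients {C = C} (rank0 (no ¬C⊥) only) = [] , [] ,
  (λ W → mk⇔ (λ CW → ⊥-elim (¬C⊥ (subst C (only W CW) CW))) λ ()) , []
VS⇒LinearQuotients (empty _ none) = [] , [] , (λ W → mk⇔ (⊥-elim ∘ none W) λ ()) , []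
VS⇒LinearQuotients {C = C} (split v _ exch vsD vsC)
  with VS⇒LinearQuotients vsD | VS⇒LinearQuotients vsC
... | LD , uniqueD , memD , lqD | LC , uniqueC , memC , lqC =
  L , unique , mem , LQ-++ (LQ-resp (λ u → mk⇔ (λ ()) (λ ())) (LQ-cone (λ _ ()) v∉LC lqC))
    (LQ-resp (λ u → mk⇔ Sum.swap Sum.swap)
      (LQ-merge cov lqD))
  where
  L = List.map (_∪ ⁅ v ⁆) LC List.++ LD
  v∉LC : All (v ∉_) LC
  v∉LC = All.tabulate λ W∈ → proj₁ (from (memC _) W∈)
  v∈cone : ∀ {W} → W ∈ₗ List.map (_∪ ⁅ v ⁆) LC → v ∈ W
  v∈cone W∈ with ∈-map⁻ (_∪ ⁅ v ⁆) W∈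
  ... | _ , _ , refl = y∈p∪⁅y⁆
  in-cone : ∀ {W} → C W → v ∈ W → W ∈ₗ List.map (_∪ ⁅ v ⁆) LC
  in-cone CW v∈W = subst (_∈ₗ _) (p-y∪⁅y⁆≡p v∈W)
    (∈-map⁺ (_∪ ⁅ v ⁆) (to (memC _) (contraction-∋ {C = C} CW v∈W)))
  unique : Unique L
  unique = Uniqueₚ.++⁺ (unique-cone v∉LC uniqueC) uniqueD λ { (W∈cone , W∈D) →
    proj₂ (from (memD _) W∈D) (v∈cone W∈cone) }
    where
    unique-cone : ∀ {L} → All (v ∉_) L → Unique L → Unique (List.map (_∪ ⁅ v ⁆) L)
    unique-cone [] [] = []
    unique-cone (v∉w ∷ v∉ws) (w∉ws ∷ u) = Allₚ.map⁺
      (All.zipWith (λ { (v∉u , w≢u) → w≢u ∘ ∪⁅⁆-injective v∉w v∉u }) (v∉ws , w∉ws))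
      ∷ unique-cone v∉ws u
  mem : ∀ W → C W ⇔ W ∈ₗ L
  mem W = mk⇔ ⇒ ⇐
    where
    ⇒ : C W → W ∈ₗ L
    ⇒ CW with v ∈? W
    ... | yes v∈W = ∈-++⁺ˡ (in-cone CW v∈W)
    ... | no v∉W = ∈-++⁺ʳ _ (to (memD W) (CW , v∉W))
    ⇐ : W ∈ₗ L → C W
    ⇐ W∈ with ∈-++⁻ (List.map (_∪ ⁅ v ⁆) LC) W∈
    ... | inj₂ W∈D = proj₁ (from (memD W) W∈D)
    ... | inj₁ W∈cone with ∈-map⁻ (_∪ ⁅ v ⁆) W∈cone
    ...   | _ , W′∈ , refl = proj₂ (from (memC _) W′∈)
  cov : ∀ {w} → w ∈ₗ LD → Covers (_∈ₗ List.map (_∪ ⁅ v ⁆) LC) w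
  cov {w} w∈ u u∈ with from (memD w) w∈
  ... | Cw , v∉w with exch w Cw v∉w
  ...   | x , x∈w , Ck = _ , in-cone Ck y∈p∪⁅y⁆ , v , v∈cone u∈ , v∉w , ∪-monoˡ-⊆ (x∈p-y⇒x∈p w)

-- Positions refer to the list of facets `List.map ∁ L`, which indexes the shelling condition.
Before : Clutter n → (L : List (Subset n)) → Fin (length (List.map ∁ L)) → Clutter n
Before P L j u = P u ⊎ ∃[ i ] (toℕ i < toℕ j × List.lookup (List.map ∁ L) i ≡ ∁ u)

∁-injective : ∀ {p q : Subset n} → ∁ p ≡ ∁ q → p ≡ q
∁-injective eq = ⊆-antisym (∁p⊆∁q⇒p⊇q (⊆-reflexive (≡.sym eq))) (∁p⊆∁q⇒p⊇q (⊆-reflexive eq))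

LQ-lookup : ∀ {P : Clutter n} {L} → LinearQuotients P L → ∀ j →
  ∃[ w ] (w ∈ₗ L × List.lookup (List.map ∁ L) j ≡ ∁ w × Covers (Before P L j) w)
LQ-lookup {P = P} (_∷_ {w} {ws} c lq) zero = w , here refl , refl , λ
  { u (inj₁ Pu) → Product.map₂ (Product.map₁ inj₁) (c u Pu) ; u (inj₂ (_ , () , _)) }
LQ-lookup {P = P} (_∷_ {w} {ws} c lq) (suc j) with LQ-lookup lq j
... | w′ , w′∈ , eq , c′ = w′ , there w′∈ , eq , λ u bef →
  Product.map₂ (Product.map₁ later) (c′ u (earlier bef))
  where
  earlier : ∀ {u} → Before P (w ∷ ws) (suc j) u → Before (λ u → P u ⊎ u ≡ w) ws j u
  earlier (inj₁ Pu) = inj₁ (inj₁ Pu)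
  earlier (inj₂ (zero , _ , eq)) = inj₁ (inj₂ (≡.sym (∁-injective eq)))
  earlier (inj₂ (suc i , s≤s i<j , eq)) = inj₂ (i , i<j , eq)
  later : ∀ {u} → Before (λ u → P u ⊎ u ≡ w) ws j u → Before P (w ∷ ws) (suc j) u
  later (inj₁ (inj₁ Pu)) = inj₁ Pu
  later (inj₁ (inj₂ refl)) = inj₂ (zero , s≤s z≤n , refl)
  later (inj₂ (i , i<j , eq)) = inj₂ (suc i , s≤s i<j , eq)

-- Circuits of equal size are incomparable, and so are their complements.
∁-Facet : ∀ {C : Clutter n} {d W} → (∀ {W} → C W → ∣ W ∣ ≡ d) → C W → Facet (Γ C) (∁ W)
∁-Facet {C = C} {d} {W} uniform CW = (W , CW , ⊆∁⇒disjoint id) , max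
  where
  max : ∀ G → Γ C G → ∁ W ⊆ G → G ≡ ∁ W
  max G (W′ , CW′ , dis) ∁W⊆G with p⊆q∧∣q∣≤∣p∣⇒p≡q
    (∁p⊆∁q⇒p⊇q (disjoint⇒⊆∁ dis ∘ ∁W⊆G))
    (ℕₚ.≤-reflexive (trans (uniform CW) (≡.sym (uniform CW′))))
  ... | refl = ⊆-antisym (disjoint⇒⊆∁ dis) ∁W⊆G

∣∁∣-suc : ∀ {p q : Subset n} → ∣ q ∣ ≡ suc ∣ p ∣ → ∣ ∁ q ∣ ≡ ℕ.pred ∣ ∁ p ∣
∣∁∣-suc {n} {p} {q} card = cong ℕ.pred (ℕₚ.+-cancelʳ-≡ (∣ p ∣) _ _ (trans
  (trans (≡.sym (ℕₚ.+-suc (∣ ∁ q ∣) (∣ p ∣))) (trans (cong (∣ ∁ q ∣ +_) (≡.sym card)) (∣∁p∣+∣p∣≡n q)))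
  (≡.sym (∣∁p∣+∣p∣≡n p))))

VS⇒Shellable : ∀ {U : Subset n} {d C} → VertexSplittable U d C → Shellable (Γ C)
VS⇒Shellable {d = d} {C} vs with VS⇒LinearQuotients vs
... | L , unique , mem , lq = List.map ∁ L , Uniqueₚ.map⁺ ∁-injective unique ,
  Allₚ.map⁺ (All.tabulate λ W∈L → ∁-Facet {C = C} uniform (from (mem _) W∈L)) ,
  complete , pure
  where
  uniform : ∀ {W} → C W → ∣ W ∣ ≡ d
  uniform CW = proj₁ (VS-bounded vs CW)
  complete : ∀ F → Facet (Γ C) F → F ∈ₗ List.map ∁ L
  complete F ((W , CW , dis) , max) = subst (_∈ₗ List.map ∁ L)
    (max (∁ W) (W , CW , ⊆∁⇒disjoint id) (disjoint⇒⊆∁ dis)) (∈-map⁺ ∁ (to (mem W) CW))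
  pure : ∀ j → PureOfSize (λ G → G ⊆ List.lookup (List.map ∁ L) j ×
           ∃[ i ] (toℕ i < toℕ j × G ⊆ List.lookup (List.map ∁ L) i))
         (ℕ.pred ∣ List.lookup (List.map ∁ L) j ∣)
  -- `G` misses `w` and `x ∈ u`, so it lies in `∁ (w ∪ ⁅ x ⁆)`, which is inside `∁ w` and the
  -- earlier `∁ k`. Maximality makes them equal, one element short of `∁ w`.
  pure j G ((G⊆j , i , i<j , G⊆i) , max) with LQ-lookup lq j | LQ-lookup lq i
  ... | w , _ , eqj , c | u , _ , eqi , _ with c u (inj₂ (i , i<j , eqi))
  ...   | k , inj₂ (i′ , i′<j , eqk) , x , x∈u , x∉w , k⊆ = ≡.subst₂ (λ G F → ∣ G ∣ ≡ ℕ.pred ∣ F ∣)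
    (max (∁ (w ∪ ⁅ x ⁆))
      ( subst (_ ⊆_) (≡.sym eqj) (p⊆q⇒∁p⊇∁q x∈p⇒x∈p∪q)
      , i′ , i′<j , subst (_ ⊆_) (≡.sym eqk) (p⊆q⇒∁p⊇∁q k⊆))
      λ y∈G → x∉p⇒x∈∁p (Sum.[ x∈∁p⇒x∉p (subst (G ⊆_) eqj G⊆j y∈G) , (λ { refl →
        x∈∁p⇒x∉p (subst (G ⊆_) eqi G⊆i y∈G) x∈u }) ]′ ∘ x∈p∪⁅y⁆⁻ w))
    (≡.sym eqj) (∣∁∣-suc {p = w} {w ∪ ⁅ x ⁆} (∣p∪⁅y⁆∣ x∉w))

Unique-lookup : ∀ {L : List (Subset n)} → Unique L → ∀ i j → toℕ i < toℕ j →
                List.lookup L i ≢ List.lookup L j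
Unique-lookup (w∉ ∷ _) zero (suc j) _ = All.lookup w∉ (∈-lookup j)
Unique-lookup (_ ∷ u) (suc i) (suc j) (s≤s i<j) = Unique-lookup u i j i<j

module _ {C : Clutter n} {d : ℕ} (uniform : ∀ {W} → C W → ∣ W ∣ ≡ 2 + d) where

  -- Let `∁ B` come after `∁ A`. Then `∁ (A ∪ B)` is maximal in the intersection of `∁ B` with the
  -- earlier facets: above it only `∁ A` and `∁ B` are facets, and `∁ B` occurs once. But it has
  -- `2 + d` elements fewer than `∁ B`, not one.
  Shellable⇒¬Gap : ∀ {A B} → Shellable (Γ C) → ¬ Gap C A B
  Shellable⇒¬Gap {A} {B} (L , unique , facets , complete , pure) g =
    separate (position (Gap.A∈C g)) (position (Gap.B∈C g))
    where
    position : ∀ {W} → C W → ∁ W ∈ₗ L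
    position CW = complete _ (∁-Facet {C = C} uniform CW)
    impossible : ∀ {A B} → Gap C A B → ∀ i j → ∁ A ≡ List.lookup L i → ∁ B ≡ List.lookup L j →
                 ¬ (toℕ i < toℕ j)
    impossible {A} {B} g i j eqi eqj i<j = ℕₚ.m≢1+m+n ∣ ∁ (A ∪ B) ∣ sizes
      where
      open Gap g
      max : ∀ G → G ⊆ List.lookup L j × (∃[ k ] (toℕ k < toℕ j × G ⊆ List.lookup L k)) →
            ∁ (A ∪ B) ⊆ G → G ≡ ∁ (A ∪ B)
      max G (G⊆j , k , k<j , G⊆k) ∁⊆G with All.lookup facets (∈-lookup k)
      ... | (W , CW , dis) , maxk with induced W CW (within-union (G⊆k ∘ ∁⊆G) dis)
      ...   | inj₁ refl = ⊆-antisym (λ x∈G → x∉p⇒x∈∁p (Sum.[ x∈∁p⇒x∉p (disjoint⇒⊆∁ dis (G⊆k x∈G))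
                , x∈∁p⇒x∉p (subst (G ⊆_) (≡.sym eqj) G⊆j x∈G) ]′ ∘ x∈p∪q⁻ A B)) ∁⊆G
      ...   | inj₂ refl = ⊥-elim (Unique-lookup unique k j k<j
                (trans (≡.sym (maxk (∁ B) (B , CW , ⊆∁⇒disjoint id) (disjoint⇒⊆∁ dis))) eqj))
      card : ∣ ∁ (A ∪ B) ∣ ≡ ℕ.pred ∣ ∁ B ∣
      card = trans (pure j (∁ (A ∪ B))
        (( subst (∁ (A ∪ B) ⊆_) eqj (p⊆q⇒∁p⊇∁q x∈q⇒x∈p∪q)
         , i , i<j , subst (∁ (A ∪ B) ⊆_) eqi (p⊆q⇒∁p⊇∁q x∈p⇒x∈p∪q)) , max))
        (cong (ℕ.pred ∘ ∣_∣) (≡.sym eqj))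
      total : ∣ ∁ (A ∪ B) ∣ + (2 + d) ≡ ∣ ∁ B ∣
      total = ℕₚ.+-cancelʳ-≡ (∣ B ∣) _ _ (trans
        (trans (ℕₚ.+-assoc (∣ ∁ (A ∪ B) ∣) (2 + d) (∣ B ∣)) (cong (∣ ∁ (A ∪ B) ∣ +_)
          (trans (cong (_+ ∣ B ∣) (≡.sym (uniform A∈C))) (≡.sym (∣p∪q∣≡∣p∣+∣q∣ A B apart)))))
        (trans (∣∁p∣+∣p∣≡n (A ∪ B)) (≡.sym (∣∁p∣+∣p∣≡n B))))
      sizes : ∣ ∁ (A ∪ B) ∣ ≡ suc (∣ ∁ (A ∪ B) ∣ + d)
      sizes = trans card (trans (cong ℕ.pred (≡.sym total))
        (cong ℕ.pred (trans (ℕₚ.+-suc _ (suc d)) (cong suc (ℕₚ.+-suc _ d)))))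
    separate : ∁ A ∈ₗ L → ¬ (∁ B ∈ₗ L)
    separate A∈L B∈L with Finₚ.<-cmp (Any.index A∈L) (Any.index B∈L)
    ... | tri< i<j _ _ = impossible g _ _ (lookup-index A∈L) (lookup-index B∈L) i<j
    ... | tri> _ _ j<i = impossible (Gap-sym g) _ _ (lookup-index B∈L) (lookup-index A∈L) j<i
    ... | tri≈ _ i≡j _ with ∁-injective {p = A} {q = B} (trans (lookup-index A∈L)
            (trans (cong (List.lookup L) i≡j) (≡.sym (lookup-index B∈L))))
    ...   | refl = let x , x∈A = ∣p∣≡1+k⇒Nonempty (uniform (Gap.A∈C g)) in
                   disjoint⁻ (Gap.apart g) x∈A x∈A

-- Chordality

Chordal-resp : ∀ {d} {C C′ : Clutter n} → (∀ S → C S ⇔ C′ S) → Chordal d C → Chordal d C′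
Chordal-resp eq (noCircuits none) = noCircuits λ E → none E ∘ from (eq E)
Chordal-resp {C = C} {C′} eq (simplicial Z (card , clique) ch) = simplicial Z
  (card , λ S cardS S⊆N → to (eq S) (clique S cardS λ x x∈S → nbhd (S⊆N x x∈S)))
  (Chordal-resp (λ S → mk⇔ (Product.map₁ (to (eq S))) (Product.map₁ (from (eq S)))) ch)
  where
  nbhd : ∀ {x} → Nbhd C′ Z x → Nbhd C Z x
  nbhd (inj₁ x∈Z) = inj₁ x∈Z
  nbhd (inj₂ (x∉Z , E , C′E , rest)) = inj₂ (x∉Z , E , from (eq E) C′E , rest)

-- The neighbourhood of the empty set consists of the vertices that are circuits, and removing the
-- empty set removes everything.
Chordal-rank1 : ∀ {C : Clutter n} → (∀ {S} → C S → ∣ S ∣ ≡ 1) → Chordal 1 C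
Chordal-rank1 {n} {C} uniform = simplicial ⊥ (cong (_+ 1) (∣⊥∣≡0 n) , clique)
  (noCircuits λ { E (_ , ⊥⊈E) → ⊥⊈E ⊥⊆ })
  where
  clique : IsClique 1 C (Nbhd C ⊥)
  clique S card S⊆N with ∣p∣≡1+k⇒Nonempty card
  ... | x , x∈S with S⊆N x x∈S
  ...   | inj₁ x∈⊥ = ⊥-elim (∉⊥ x∈⊥)
  ...   | inj₂ (_ , E , CE , x∈E , _) = subst C
            (trans (≡.sym (one-element x∈E (uniform CE))) (one-element x∈S card)) CE
    where
    one-element : ∀ {p x} → x ∈ p → ∣ p ∣ ≡ 1 → ⁅ x ⁆ ≡ p
    one-element {x = x} x∈p card = p⊆q∧∣q∣≤∣p∣⇒p≡q
      (λ y∈ → subst (_∈ _) (≡.sym (x∈⁅y⁆⇒x≡y x y∈)) x∈p)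
      (ℕₚ.≤-reflexive (trans card (≡.sym (∣⁅x⁆∣≡1 x))))

-- D is the contraction of C at v; the maximal subcircuits Z of D are removed from C as Z ∪ ⁅ v ⁆,
-- until no circuit contains v. The second hypothesis survives the removals, since D only shrinks.
Chordal-lift : ∀ {d} {D C : Clutter n} {v} → Chordal d D → (∀ T → D T ⇔ contraction C v T) →
  (∀ S → v ∉ S → ∣ S ∣ ≡ suc d → (∀ x → x ∈ S → D (S - x)) → C S) →
  (∀ {S} → C S → ∣ S ∣ ≡ suc d) →
  Chordal (suc d) (deletion C v) → Chordal (suc d) C
Chordal-lift {D = D} {C} {v} (noCircuits none) con closed uniform rest =
  Chordal-resp (λ S → mk⇔ proj₁ λ CS → CS , λ v∈S → none _ (from (con _) (contraction-∋ {C = C} CS v∈S))) rest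
Chordal-lift {d = d} {D} {C} {v} (simplicial Z (card , clique) ch) con closed uniform rest with v ∈? Z
-- Circuits of `D` avoid `v`, so removing this `Z` changes nothing and the step is skipped.
... | yes v∈Z = Chordal-lift ch
  (λ T → mk⇔ (to (con T) ∘ proj₁) (λ cT → from (con T) cT , λ Z⊆T → proj₁ cT (Z⊆T v∈Z)))
  (λ S v∉S cardS DS → closed S v∉S cardS (λ x x∈S → proj₁ (DS x x∈S)))
  uniform rest
... | no v∉Z = simplicial (Z ∪ ⁅ v ⁆)
  (trans (cong (_+ 1) (∣p∪⁅y⁆∣ v∉Z)) (cong suc card) , clique′)
  (Chordal-lift ch
    (λ T → mk⇔
      (λ { (DT , Z⊈T) → let v∉T , CT = to (con T) DT in
           v∉T , CT , λ ⊆ → Z⊈T (λ x∈Z → x∈p∪⁅y⁆∧x≢y⇒x∈p T (⊆ (x∈p⇒x∈p∪q x∈Z)) λ { refl → v∉Z x∈Z }) })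
      (λ { (v∉T , CT , Z+v⊈) → from (con T) (v∉T , CT) , λ Z⊆T → Z+v⊈ (∪-monoˡ-⊆ Z⊆T) }))
    (λ S v∉S cardS DS → closed S v∉S cardS (λ x x∈S → proj₁ (DS x x∈S)) , λ Z+v⊆S → v∉S (Z+v⊆S y∈p∪⁅y⁆))
    (uniform ∘ proj₁)
    (Chordal-resp (λ S → mk⇔
      (λ { (CS , v∉S) → (CS , λ Z+v⊆S → v∉S (Z+v⊆S y∈p∪⁅y⁆)) , v∉S })
      (λ { ((CS , _) , v∉S) → CS , v∉S })) rest))
  where
  -- For `x` outside `Z ∪ ⁅ v ⁆`, a circuit `E` inside the enlarged set has its full size, hence
  -- contains `v`, and `E - v` is a circuit of `D`.
  nbhd : ∀ {x} → x ≢ v → Nbhd C (Z ∪ ⁅ v ⁆) x → Nbhd D Z x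
  nbhd x≢v (inj₁ x∈) = inj₁ (x∈p∪⁅y⁆∧x≢y⇒x∈p Z x∈ x≢v)
  nbhd {x} x≢v (inj₂ (x∉ , E , CE , x∈E , E⊆)) = inj₂ (x∉ ∘ x∈p⇒x∈p∪q , E - v ,
    from (con _) (contraction-∋ {C = C} CE v∈E) , x∈p∧x≢y⇒x∈p-y x∈E x≢v , E-v⊆)
    where
    v∈E : v ∈ E
    v∈E = subst (v ∈_) (≡.sym (p⊆q∧∣q∣≤∣p∣⇒p≡q E⊆ (ℕₚ.≤-reflexive (trans (∣p∪⁅y⁆∣ x∉)
      (trans (cong suc (trans (∣p∪⁅y⁆∣ v∉Z) (trans (ℕₚ.+-comm 1 (∣ Z ∣)) card))) (≡.sym (uniform CE)))))))
      (x∈p⇒x∈p∪q y∈p∪⁅y⁆)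
    E-v⊆ : E - v ⊆ Z ∪ ⁅ x ⁆
    E-v⊆ y∈ with x∈p∪⁅y⁆⁻ (Z ∪ ⁅ v ⁆) (E⊆ (x∈p-y⇒x∈p E y∈))
    ... | inj₁ y∈Z+v = x∈p⇒x∈p∪q (x∈p∪⁅y⁆∧x≢y⇒x∈p Z y∈Z+v (x∈p-y⇒x≢y E y∈))
    ... | inj₂ refl = y∈p∪⁅y⁆
  -- For `S` through `v` the clique of `D` yields `S - v`. For `S` without `v` it yields every
  -- `S - x`, and `closed` applies.
  clique′ : IsClique (suc d) C (Nbhd C (Z ∪ ⁅ v ⁆))
  clique′ S cardS S⊆N with v ∈? S
  ... | yes v∈S = subst C (p-y∪⁅y⁆≡p v∈S) (proj₂ (to (con _) (clique (S - v) (∣p-y∣≡ v∈S cardS)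
    λ x x∈ → nbhd (x∈p-y⇒x≢y S x∈) (S⊆N x (x∈p-y⇒x∈p S x∈)))))
  ... | no v∉S = closed S v∉S cardS λ x x∈S → clique (S - x) (∣p-y∣≡ x∈S cardS)
    λ y y∈ → nbhd (λ { refl → v∉S (x∈p-y⇒x∈p S y∈) }) (S⊆N y (x∈p-y⇒x∈p S y∈))

CoClutter : Subset n → ℕ → Clutter n → Clutter n
CoClutter U d C S = Complete U d S × ¬ C S

-- Complementation commutes with deletion and contraction. The closure hypothesis of `Chordal-lift`
-- is the contrapositive of the exchange: if `S` were in `C`, some `S - x` would be in the
-- contraction.
VS⇒Chordal : ∀ {U : Subset n} {d C} → VertexSplittable U (suc d) C →
             Chordal (suc d) (CoClutter U (suc d) C)
VS⇒Chordal (empty U-empty _) = noCircuits λ { E ((card , E⊆U) , _) →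
  U-empty (Product.map₂ E⊆U (∣p∣≡1+k⇒Nonempty card)) }
-- The contraction would have rank 0, where no subcircuit of size `d - 1` exists.
VS⇒Chordal {d = zero} (split _ _ _ _ _) = Chordal-rank1 (proj₁ ∘ proj₁)
VS⇒Chordal {U = U} {suc d} {C} (split v v∈U exch vsD vsC) =
  Chordal-lift (VS⇒Chordal vsC) con closed (proj₁ ∘ proj₁) (Chordal-resp del′ (VS⇒Chordal vsD))
  where
  con : ∀ T → CoClutter (U - v) (suc d) (contraction C v) T ⇔ contraction (CoClutter U (2 + d) C) v T
  con T = mk⇔
    (λ { ((card , T⊆) , ¬CT) → let v∉T = x∉p-x U v ∘ T⊆ in
         v∉T , (trans (∣p∪⁅y⁆∣ v∉T) (cong suc card) , ∪⁅⁆-⊆ (x∈p-y⇒x∈p U ∘ T⊆) v∈U)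
             , λ CT → ¬CT (v∉T , CT) })
    (λ { (v∉T , (card , T+v⊆) , ¬CT) →
         ( ℕₚ.suc-injective (trans (≡.sym (∣p∪⁅y⁆∣ v∉T)) card)
         , p⊆q-y (T+v⊆ ∘ x∈p⇒x∈p∪q) v∉T) , ¬CT ∘ proj₂ })
  del′ : ∀ S → CoClutter (U - v) (2 + d) (deletion C v) S ⇔ deletion (CoClutter U (2 + d) C) v S
  del′ S = mk⇔
    (λ { ((card , S⊆) , ¬CS) → let v∉S = x∉p-x U v ∘ S⊆ in
         ((card , x∈p-y⇒x∈p U ∘ S⊆) , λ CS → ¬CS (CS , v∉S)) , v∉S })
    (λ { (((card , S⊆) , ¬CS) , v∉S) → (card , p⊆q-y S⊆ v∉S) , ¬CS ∘ proj₁ })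
  closed : ∀ S → v ∉ S → ∣ S ∣ ≡ 2 + d →
           (∀ x → x ∈ S → CoClutter (U - v) (suc d) (contraction C v) (S - x)) →
           CoClutter U (2 + d) C S
  closed S v∉S card co = (card , S⊆U) , ¬CS
    where
    -- Each element of `S` survives the removal of a different one.
    S⊆U : S ⊆ U
    S⊆U {x} x∈S with two-elements card
    ... | a , b , a∈S , b∈S , a≢b with x Finₚ.≟ a
    ...   | yes refl = x∈p-y⇒x∈p U (proj₂ (proj₁ (co b b∈S)) (x∈p∧x≢y⇒x∈p-y a∈S a≢b))
    ...   | no x≢a = x∈p-y⇒x∈p U (proj₂ (proj₁ (co a a∈S)) (x∈p∧x≢y⇒x∈p-y x∈S x≢a))
    ¬CS : ¬ C S
    ¬CS CS with exch S CS v∉S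
    ... | x , x∈S , C′ = proj₂ (co x x∈S) (v∉S ∘ x∈p-y⇒x∈p S , C′)

VS⇒CoChordal : ∀ {d} {C : Clutter n} → VertexSplittable ⊤ (suc d) C → CoChordal (suc d) C
VS⇒CoChordal {d = d} {C} vs = Chordal-resp
  (λ S → mk⇔ (λ { ((card , _) , ¬CS) → card , ¬CS }) (inside S))
  (VS⇒Chordal vs)
  where
  inside : ∀ S → complementClutter (suc d) C S → CoClutter ⊤ (suc d) C S
  inside S (card , ¬CS) = (card , ⊆⊤) , ¬CS

-- Every vertex of B extends a subcircuit Z ⊆ A, and every vertex of A extends a subcircuit
-- Z ⊆ A ∪ B with Z ⊈ A; so B or A would be a circuit. If Z ⊈ A ∪ B, then no subset of A ∪ B
-- is removed.
Chordal⇒¬two-missing : ∀ {D : Clutter n} {d A B} → Chordal (2 + d) D →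
  ∣ A ∣ ≡ 2 + d → ∣ B ∣ ≡ 2 + d → Disjoint A B → ¬ D A → ¬ D B →
  ¬ (∀ S → ∣ S ∣ ≡ 2 + d → S ⊆ A ∪ B → S ≢ A → S ≢ B → D S)
Chordal⇒¬two-missing {A = A} {B} (noCircuits none) cardA cardB apart _ _ others
  with two-elements cardA | ∣p∣≡1+k⇒Nonempty cardB
-- Trading `a` for `b` gives a third set: it contains `b`, so it is not `A`, and keeps `a′`, so it
-- is not `B`.
... | a , a′ , a∈A , a′∈A , a≢a′ | b , b∈B = none _ (others ((A - a) ∪ ⁅ b ⁆)
  (trans (∣p-x∪⁅y⁆∣ a∈A b∉A) cardA)
  (∪⁅⁆-⊆ (x∈p⇒x∈p∪q ∘ x∈p-y⇒x∈p A) (x∈q⇒x∈p∪q b∈B))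
  (λ eq → b∉A (subst (b ∈_) eq y∈p∪⁅y⁆))
  (λ eq → disjoint⁻ apart a′∈A (subst (a′ ∈_) eq (x∈p⇒x∈p∪q (x∈p∧x≢y⇒x∈p-y a′∈A (a≢a′ ∘ ≡.sym))))))
  where
  b∉A : b ∉ A
  b∉A b∈A = disjoint⁻ apart b∈A b∈B
Chordal⇒¬two-missing {D = D} {d} {A} {B} (simplicial Z (card , clique) ch) cardA cardB apart ¬DA ¬DB others
  with Z ⊆? A ∪ B
... | no Z⊈ = Chordal⇒¬two-missing ch cardA cardB apart (¬DA ∘ proj₁) (¬DB ∘ proj₁)
  λ S cardS S⊆ S≢A S≢B → others S cardS S⊆ S≢A S≢B , λ Z⊆S → Z⊈ (S⊆ ∘ Z⊆S)
... | yes Z⊆ = contradiction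
  where
  extends : ∀ x → x ∈ A ∪ B → Z ∪ ⁅ x ⁆ ≢ A → Z ∪ ⁅ x ⁆ ≢ B → Nbhd D Z x
  extends x x∈ ≢A ≢B with x ∈? Z
  ... | yes x∈Z = inj₁ x∈Z
  ... | no x∉Z = inj₂ (x∉Z , Z ∪ ⁅ x ⁆ , others _
    (trans (∣p∪⁅y⁆∣ x∉Z) (trans (ℕₚ.+-comm 1 (∣ Z ∣)) card)) (∪⁅⁆-⊆ Z⊆ x∈) ≢A ≢B , y∈p∪⁅y⁆ , id)
  contradiction : Empty.⊥
  contradiction with Z ⊆? A
  ... | no Z⊈A = ¬DA (clique A cardA λ x x∈A → extends x (x∈p⇒x∈p∪q x∈A)
    (λ { refl → Z⊈A x∈p⇒x∈p∪q }) (λ { refl → disjoint⁻ apart x∈A y∈p∪⁅y⁆ }))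
  ... | yes Z⊆A = ¬DB (clique B cardB λ x x∈B → extends x (x∈q⇒x∈p∪q x∈B)
    (λ { refl → disjoint⁻ apart y∈p∪⁅y⁆ x∈B })
    (λ { refl → let z , z∈Z = ∣p∣≡1+k⇒Nonempty {p = Z} (ℕₚ.suc-injective (trans (ℕₚ.+-comm 1 (∣ Z ∣)) card)) in
                disjoint⁻ apart (Z⊆A z∈Z) (x∈p⇒x∈p∪q z∈Z) }))

CoChordal⇒¬Gap : ∀ {C : Clutter n} {d A B} → (∀ {W} → C W → ∣ W ∣ ≡ 2 + d) →
                 CoChordal (2 + d) C → ¬ Gap C A B
CoChordal⇒¬Gap {A = A} {B} uniform ch g = Chordal⇒¬two-missing {A = A} {B} ch
  (uniform A∈C) (uniform B∈C) apart (λ { (_ , ¬CA) → ¬CA A∈C }) (λ { (_ , ¬CB) → ¬CB B∈C })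
  λ S card S⊆ S≢A S≢B → card , λ CS → Sum.[ S≢A , S≢B ]′ (induced S CS S⊆)
  where open Gap g

-- Homology

infix 4 _≟ₛ_
_≟ₛ_ : DecidableEquality (Subset n)
_≟ₛ_ = Vecₚ.≡-dec Boolₚ._≟_

module _ {c ℓ} (K : Field c ℓ) where

  open Field K using (Carrier; _≈_; 0#; 1#; 0≉1; setoid; +-abelianGroup; +-commutativeMonoid;
                      +-cong; +-congʳ; +-congˡ; +-identityˡ; +-identityʳ; +-assoc;
                      -‿inverseʳ; -‿inverseˡ; -‿cong)
    renaming (_+_ to infixl 6 _⊹_; -_ to infix 8 ⊖_;
              refl to ≈-refl; sym to ≈-sym; trans to ≈-trans; reflexive to ≈-reflexive)
  open Algebra.Properties.AbelianGroup +-abelianGroup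
    using () renaming (⁻¹-∙-comm to ⊖-⊹-comm)
  open Algebra.Properties.Group (Algebra.Bundles.AbelianGroup.group +-abelianGroup)
    using () renaming (ε⁻¹≈ε to ⊖0≈0; ⁻¹-involutive to ⊖-involutive)
  open Algebra.Properties.CommutativeMonoid.Sum +-commutativeMonoid
    using (sum; sum-cong-≋; ∑-distrib-+; sum-replicate-zero)
  module ≈-Reasoning = Relation.Binary.Reasoning.Setoid setoid

  alt-cong : ∀ m {x y} → x ≈ y → alt K m x ≈ alt K m y
  alt-cong zero eq = eq
  alt-cong (suc m) eq = -‿cong (alt-cong m eq)

  alt-0 : ∀ m → alt K m 0# ≈ 0#
  alt-0 zero = ≈-refl
  alt-0 (suc m) = ≈-trans (-‿cong (alt-0 m)) ⊖0≈0

  alt-⊹ : ∀ m x y → alt K m (x ⊹ y) ≈ alt K m x ⊹ alt K m y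
  alt-⊹ zero x y = ≈-refl
  alt-⊹ (suc m) x y = ≈-trans (-‿cong (alt-⊹ m x y)) (≈-sym (⊖-⊹-comm _ _))

  alt-∘ : ∀ m k x → alt K m (alt K k x) ≡ alt K (m + k) x
  alt-∘ zero k x = refl
  alt-∘ (suc m) k x = cong ⊖_ (alt-∘ m k x)

  alt-comm : ∀ m k x → alt K m (alt K k x) ≡ alt K k (alt K m x)
  alt-comm m k x = trans (alt-∘ m k x) (trans (cong (λ j → alt K j x) (ℕₚ.+-comm m k)) (≡.sym (alt-∘ k m x)))

  alt-⊖ : ∀ m x → alt K m (⊖ x) ≡ ⊖ alt K m x
  alt-⊖ m x = alt-comm m 1 x

  alt-involutive : ∀ m x → alt K m (alt K m x) ≈ x
  alt-involutive zero x = ≈-refl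
  alt-involutive (suc m) x = ≈-trans (-‿cong (≈-reflexive (alt-⊖ m _)))
    (≈-trans (⊖-involutive _) (alt-involutive m x))

  ΣFin≡sum : ∀ {n} (f : Fin n → Carrier) → ΣFin K f ≡ sum f
  ΣFin≡sum f = trans (cong (List.foldr _⊹_ 0#) (Listₚ.map-tabulate id f)) (foldr-tabulate f)
    where
    foldr-tabulate : ∀ {n} (f : Fin n → Carrier) → List.foldr _⊹_ 0# (List.tabulate f) ≡ sum f
    foldr-tabulate {zero} f = refl
    foldr-tabulate {suc n} f = cong (f zero ⊹_) (foldr-tabulate (f ∘ suc))

  sum-⊖ : ∀ {n} (f : Fin n → Carrier) → sum (λ i → ⊖ f i) ≈ ⊖ sum f
  sum-⊖ {zero} f = ≈-sym ⊖0≈0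
  sum-⊖ {suc n} f = ≈-trans (+-congˡ (sum-⊖ (f ∘ suc))) (⊖-⊹-comm _ _)

  sum-zero : ∀ {n} (f : Fin n → Carrier) → (∀ i → f i ≈ 0#) → sum f ≈ 0#
  sum-zero {n} f f≈0 = ≈-trans (sum-cong-≋ f≈0) (sum-replicate-zero n)

  sum-single : ∀ {n} (f : Fin n → Carrier) i → (∀ j → j ≢ i → f j ≈ 0#) → sum f ≈ f i
  sum-single f zero f≈0 = ≈-trans (+-congˡ (sum-zero (f ∘ suc) λ j → f≈0 (suc j) λ ())) (+-identityʳ _)
  sum-single f (suc i) f≈0 = ≈-trans (+-cong (f≈0 zero λ ()) (sum-single (f ∘ suc) i λ j j≢i →
    f≈0 (suc j) (j≢i ∘ Finₚ.suc-injective))) (+-identityˡ _)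

  -- The first row cancels the first column. Vanishing on the diagonal is assumed separately, since
  -- antisymmetry does not give it in characteristic 2.
  sum-antisym : ∀ {n} (h : Fin n → Fin n → Carrier) → (∀ i → h i i ≈ 0#) →
                (∀ i j → h i j ≈ ⊖ h j i) → sum (λ i → sum (h i)) ≈ 0#
  sum-antisym {zero} h diag anti = ≈-refl
  sum-antisym {suc n} h diag anti = begin
    (h zero zero ⊹ row) ⊹ sum (λ i → h (suc i) zero ⊹ sum (h (suc i) ∘ suc))
      ≈⟨ +-cong (≈-trans (+-congʳ (diag zero)) (+-identityˡ _))
                (∑-distrib-+ (λ i → h (suc i) zero) (λ i → sum (h (suc i) ∘ suc))) ⟩
    row ⊹ (sum (λ i → h (suc i) zero) ⊹ sum (λ i → sum (h (suc i) ∘ suc)))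
      ≈⟨ +-congˡ (+-cong (≈-trans (sum-cong-≋ λ i → anti (suc i) zero) (sum-⊖ (h zero ∘ suc)))
           (sum-antisym (λ i j → h (suc i) (suc j)) (diag ∘ suc) (λ i j → anti (suc i) (suc j)))) ⟩
    row ⊹ (⊖ row ⊹ 0#)  ≈⟨ +-congˡ (+-identityʳ _) ⟩
    row ⊹ ⊖ row         ≈⟨ -‿inverseʳ row ⟩
    0#                  ∎
    where
    open ≈-Reasoning
    row = sum (h zero ∘ suc)

  Coefficients : ℕ → Set c
  Coefficients n = Subset n → Carrier

  private variable
    T S : Subset n
    u v : Fin n

  sign : Subset n → Fin n → ℕ
  sign T v = ∣ T ∩ below K v ∣

  -- The summand of `∂` at one vertex. These operators anticommute and square to zero, which gives
  -- `∂∂≈0`; moreover `∂ₚ v x` is the part of `x` in the link of `v`.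
  ∂ₚ : Fin n → Coefficients n → Coefficients n
  ∂ₚ v x T = if Vec.lookup T v then 0# else alt K (sign T v) (x (T ∪ ⁅ v ⁆))

  ∂≡sum : ∀ (x : Coefficients n) T → ∂ K x T ≡ sum (λ v → ∂ₚ v x T)
  ∂≡sum x T = ΣFin≡sum (λ v → ∂ₚ v x T)

  ∂ₚ-in : ∀ (x : Coefficients n) → v ∈ T → ∂ₚ v x T ≡ 0#
  ∂ₚ-in x v∈T rewrite Vecₚ.[]=⇒lookup v∈T = refl

  ∂ₚ-out : ∀ (x : Coefficients n) → v ∉ T → ∂ₚ v x T ≡ alt K (sign T v) (x (T ∪ ⁅ v ⁆))
  ∂ₚ-out {v = v} {T} x v∉T with Vec.lookup T v in eq
  ... | true = ⊥-elim (v∉T (Vecₚ.lookup⇒[]= v T eq))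
  ... | false = refl

  ∂ₚ-cong : ∀ (x y : Coefficients n) v T → x (T ∪ ⁅ v ⁆) ≈ y (T ∪ ⁅ v ⁆) → ∂ₚ v x T ≈ ∂ₚ v y T
  ∂ₚ-cong x y v T eq with Vec.lookup T v
  ... | true = ≈-refl
  ... | false = alt-cong (sign T v) eq

  ∂ₚ-0 : ∀ (x : Coefficients n) v T → x (T ∪ ⁅ v ⁆) ≈ 0# → ∂ₚ v x T ≈ 0#
  ∂ₚ-0 x v T eq with Vec.lookup T v
  ... | true = ≈-refl
  ... | false = ≈-trans (alt-cong (sign T v) eq) (alt-0 (sign T v))

  ∂ₚ-⊹ : ∀ (x y : Coefficients n) v T → ∂ₚ v (λ S → x S ⊹ y S) T ≈ ∂ₚ v x T ⊹ ∂ₚ v y T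
  ∂ₚ-⊹ x y v T with Vec.lookup T v
  ... | true = ≈-sym (+-identityˡ _)
  ... | false = alt-⊹ (sign T v) _ _

  ∂ₚ-⊖ : ∀ (x : Coefficients n) v T → ∂ₚ v (λ S → ⊖ x S) T ≈ ⊖ ∂ₚ v x T
  ∂ₚ-⊖ x v T with Vec.lookup T v
  ... | true = ≈-sym ⊖0≈0
  ... | false = ≈-reflexive (alt-⊖ (sign T v) _)

  ∂ₚ-sum : ∀ {m} (f : Fin m → Coefficients n) v T →
           ∂ₚ v (λ S → sum (λ i → f i S)) T ≈ sum (λ i → ∂ₚ v (f i) T)
  ∂ₚ-sum {m = zero} f v T = ∂ₚ-0 (λ _ → 0#) v T ≈-refl
  ∂ₚ-sum {m = suc m} f v T = ≈-trans
    (∂ₚ-⊹ (f zero) (λ S → sum (λ i → f (suc i) S)) v T) (+-congˡ (∂ₚ-sum (f ∘ suc) v T))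

  ∂-cong : ∀ (x y : Coefficients n) T → (∀ v → x (T ∪ ⁅ v ⁆) ≈ y (T ∪ ⁅ v ⁆)) → ∂ K x T ≈ ∂ K y T
  ∂-cong x y T eq = ≡.subst₂ _≈_ (≡.sym (∂≡sum x T)) (≡.sym (∂≡sum y T))
    (sum-cong-≋ λ v → ∂ₚ-cong x y v T (eq v))

  ∂-⊹ : ∀ (x y : Coefficients n) T → ∂ K (λ S → x S ⊹ y S) T ≈ ∂ K x T ⊹ ∂ K y T
  ∂-⊹ x y T = ≡.subst₂ _≈_ (≡.sym (∂≡sum (λ S → x S ⊹ y S) T))
    (≡.cong₂ _⊹_ (≡.sym (∂≡sum x T)) (≡.sym (∂≡sum y T)))
    (≈-trans (sum-cong-≋ λ v → ∂ₚ-⊹ x y v T) (∑-distrib-+ (λ v → ∂ₚ v x T) (λ v → ∂ₚ v y T)))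

  ∂-⊖ : ∀ (x : Coefficients n) T → ∂ K (λ S → ⊖ x S) T ≈ ⊖ ∂ K x T
  ∂-⊖ x T = ≡.subst₂ _≈_ (≡.sym (∂≡sum (λ S → ⊖ x S) T)) (cong ⊖_ (≡.sym (∂≡sum x T)))
    (≈-trans (sum-cong-≋ λ v → ∂ₚ-⊖ x v T) (sum-⊖ (λ v → ∂ₚ v x T)))

  ∂-0 : ∀ (x : Coefficients n) T → (∀ v → x (T ∪ ⁅ v ⁆) ≈ 0#) → ∂ K x T ≈ 0#
  ∂-0 x T eq = subst (_≈ 0#) (≡.sym (∂≡sum x T)) (sum-zero (λ v → ∂ₚ v x T) λ v → ∂ₚ-0 x v T (eq v))

  below⁺ : ∀ {u v : Fin n} → toℕ u < toℕ v → u ∈ below K v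
  below⁺ {u = u} {v} u<v = Vecₚ.lookup⇒[]= u _
    (trans (Vecₚ.lookup∘tabulate _ u) (to Boolₚ.T-≡ (ℕₚ.<⇒<ᵇ u<v)))

  below⁻ : ∀ {u v : Fin n} → u ∈ below K v → toℕ u < toℕ v
  below⁻ {u = u} {v} u∈ = ℕₚ.<ᵇ⇒< _ _ (from Boolₚ.T-≡
    (trans (≡.sym (Vecₚ.lookup∘tabulate _ u)) (Vecₚ.[]=⇒lookup u∈)))

  sign-above : ∀ (T : Subset n) {u v} → ¬ (toℕ u < toℕ v) → sign (T ∪ ⁅ u ⁆) v ≡ sign T v
  sign-above T {u} {v} u≮v = cong ∣_∣ (⊆-antisym
    (λ x∈ → let x∈T+u , x<v = x∈p∩q⁻ (T ∪ ⁅ u ⁆) _ x∈ in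
            x∈p∩q⁺ (x∈p∪⁅y⁆∧x≢y⇒x∈p T x∈T+u (λ { refl → u≮v (below⁻ x<v) }) , x<v))
    (λ x∈ → let x∈T , x<v = x∈p∩q⁻ T _ x∈ in x∈p∩q⁺ (x∈p⇒x∈p∪q x∈T , x<v)))

  sign-below : ∀ (T : Subset n) {u v} → u ∉ T → toℕ u < toℕ v → sign (T ∪ ⁅ u ⁆) v ≡ suc (sign T v)
  sign-below T {u} {v} u∉T u<v = trans (cong ∣_∣ (⊆-antisym
    (λ x∈ → let x∈T+u , x<v = x∈p∩q⁻ (T ∪ ⁅ u ⁆) _ x∈ in Sum.[
       (λ x∈T → x∈p⇒x∈p∪q (x∈p∩q⁺ (x∈T , x<v))) , (λ { refl → y∈p∪⁅y⁆ }) ]′ (x∈p∪⁅y⁆⁻ T x∈T+u))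
    (∪⁅⁆-⊆ (λ x∈ → let x∈T , x<v = x∈p∩q⁻ T _ x∈ in x∈p∩q⁺ (x∈p⇒x∈p∪q x∈T , x<v))
           (x∈p∩q⁺ (y∈p∪⁅y⁆ , below⁺ u<v)))))
    (∣p∪⁅y⁆∣ (u∉T ∘ proj₁ ∘ x∈p∩q⁻ T _))

  ∪⁅⁆-swap : ∀ (T : Subset n) u v → (T ∪ ⁅ u ⁆) ∪ ⁅ v ⁆ ≡ (T ∪ ⁅ v ⁆) ∪ ⁅ u ⁆
  ∪⁅⁆-swap T u v = trans (∪-assoc T ⁅ u ⁆ ⁅ v ⁆)
    (trans (cong (T ∪_) (∪-comm ⁅ u ⁆ ⁅ v ⁆)) (≡.sym (∪-assoc T ⁅ v ⁆ ⁅ u ⁆)))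

  ∂ₚ∂ₚ-out : ∀ (x : Coefficients n) → u ≢ v → u ∉ T → v ∉ T →
    ∂ₚ u (∂ₚ v x) T ≡ alt K (sign T u) (alt K (sign (T ∪ ⁅ u ⁆) v) (x ((T ∪ ⁅ u ⁆) ∪ ⁅ v ⁆)))
  ∂ₚ∂ₚ-out {u = u} {v} {T} x u≢v u∉T v∉T = trans (∂ₚ-out (∂ₚ v x) u∉T)
    (cong (alt K (sign T u)) (∂ₚ-out x λ v∈ → v∉T (x∈p∪⁅y⁆∧x≢y⇒x∈p T v∈ (u≢v ∘ ≡.sym))))

  -- Inserting the smaller vertex `u` shifts the position of `v`, but not conversely, so exactly one
  -- order of removal picks up an extra sign.
  ∂ₚ-anticomm-< : ∀ (x : Coefficients n) → toℕ u < toℕ v → u ∉ T → v ∉ T →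
                  ∂ₚ u (∂ₚ v x) T ≡ ⊖ ∂ₚ v (∂ₚ u x) T
  ∂ₚ-anticomm-< {u = u} {v} {T} x u<v u∉T v∉T = begin
    ∂ₚ u (∂ₚ v x) T
      ≡⟨ ∂ₚ∂ₚ-out x u≢v u∉T v∉T ⟩
    alt K (sign T u) (alt K (sign (T ∪ ⁅ u ⁆) v) (x ((T ∪ ⁅ u ⁆) ∪ ⁅ v ⁆)))
      ≡⟨ ≡.cong₂ (λ k S → alt K (sign T u) (alt K k (x S))) (sign-below T u∉T u<v) (∪⁅⁆-swap T u v) ⟩
    alt K (sign T u) (⊖ alt K (sign T v) (x ((T ∪ ⁅ v ⁆) ∪ ⁅ u ⁆)))
      ≡⟨ alt-⊖ (sign T u) _ ⟩
    ⊖ alt K (sign T u) (alt K (sign T v) (x ((T ∪ ⁅ v ⁆) ∪ ⁅ u ⁆)))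
      ≡⟨ cong ⊖_ (alt-comm (sign T u) (sign T v) _) ⟩
    ⊖ alt K (sign T v) (alt K (sign T u) (x ((T ∪ ⁅ v ⁆) ∪ ⁅ u ⁆)))
      ≡⟨ cong (λ k → ⊖ alt K (sign T v) (alt K k (x ((T ∪ ⁅ v ⁆) ∪ ⁅ u ⁆)))) (sign-above T (ℕₚ.<⇒≯ u<v)) ⟨
    ⊖ alt K (sign T v) (alt K (sign (T ∪ ⁅ v ⁆) u) (x ((T ∪ ⁅ v ⁆) ∪ ⁅ u ⁆)))
      ≡⟨ cong ⊖_ (∂ₚ∂ₚ-out x (u≢v ∘ ≡.sym) v∉T u∉T) ⟨
    ⊖ ∂ₚ v (∂ₚ u x) T ∎
    where
    open ≡.≡-Reasoning
    u≢v : u ≢ v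
    u≢v refl = ℕₚ.<-irrefl refl u<v

  ∂ₚ∂ₚ-in : ∀ (x : Coefficients n) u v → v ∈ T → ∂ₚ u (∂ₚ v x) T ≈ 0#
  ∂ₚ∂ₚ-in {T = T} x u v v∈T = ∂ₚ-0 (∂ₚ v x) u T (≈-reflexive (∂ₚ-in x (x∈p⇒x∈p∪q v∈T)))

  ∂ₚ-square : ∀ (x : Coefficients n) v T → ∂ₚ v (∂ₚ v x) T ≈ 0#
  ∂ₚ-square x v T = ∂ₚ-0 (∂ₚ v x) v T (≈-reflexive (∂ₚ-in x (y∈p∪⁅y⁆ {p = T})))

  ∂ₚ-anticomm : ∀ (x : Coefficients n) u v T → ∂ₚ u (∂ₚ v x) T ≈ ⊖ ∂ₚ v (∂ₚ u x) T
  ∂ₚ-anticomm x u v T with u ∈? T | v ∈? T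
  ... | yes u∈T | _ = ≈-trans (≈-reflexive (∂ₚ-in (∂ₚ v x) u∈T))
    (≈-sym (≈-trans (-‿cong (∂ₚ∂ₚ-in x v u u∈T)) ⊖0≈0))
  ... | no _ | yes v∈T = ≈-trans (∂ₚ∂ₚ-in x u v v∈T)
    (≈-sym (≈-trans (-‿cong (≈-reflexive (∂ₚ-in (∂ₚ u x) v∈T))) ⊖0≈0))
  ... | no u∉T | no v∉T with Finₚ.<-cmp u v
  ...   | tri< u<v _ _ = ≈-reflexive (∂ₚ-anticomm-< x u<v u∉T v∉T)
  ...   | tri≈ _ refl _ = ≈-trans (∂ₚ-square x u T) (≈-sym (≈-trans (-‿cong (∂ₚ-square x u T)) ⊖0≈0))
  ...   | tri> _ _ v<u = ≈-sym (≈-trans (-‿cong (≈-reflexive (∂ₚ-anticomm-< x v<u v∉T u∉T))) (⊖-involutive _))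

  ∂ₚ-∂ : ∀ (x : Coefficients n) v T → ∂ₚ v (∂ K x) T ≈ sum (λ u → ∂ₚ v (∂ₚ u x) T)
  ∂ₚ-∂ x v T = ≈-trans
    (∂ₚ-cong (∂ K x) (λ S → sum (λ u → ∂ₚ u x S)) v T (≈-reflexive (∂≡sum x (T ∪ ⁅ v ⁆))))
    (∂ₚ-sum (λ u → ∂ₚ u x) v T)

  ∂∂≈0 : ∀ (x : Coefficients n) T → ∂ K (∂ K x) T ≈ 0#
  ∂∂≈0 x T = ≈-trans (≈-reflexive (∂≡sum (∂ K x) T)) (≈-trans (sum-cong-≋ λ v → ∂ₚ-∂ x v T)
    (sum-antisym (λ v u → ∂ₚ v (∂ₚ u x) T) (λ v → ∂ₚ-square x v T) (λ v u → ∂ₚ-anticomm x v u T)))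

  ∂-∂ₚ : ∀ (x : Coefficients n) v T → ∂ K (∂ₚ v x) T ≈ ⊖ ∂ₚ v (∂ K x) T
  ∂-∂ₚ x v T = ≈-trans (≈-reflexive (∂≡sum (∂ₚ v x) T)) (≈-trans (sum-cong-≋ λ u → ∂ₚ-anticomm x u v T)
    (≈-trans (sum-⊖ (λ u → ∂ₚ v (∂ₚ u x) T)) (-‿cong (≈-sym (∂ₚ-∂ x v T)))))

  ∂ₚ≈0⇒≈0 : ∀ (x : Coefficients n) → (∀ T → ∂ₚ v x T ≈ 0#) → v ∈ S → x S ≈ 0#
  ∂ₚ≈0⇒≈0 {v = v} {S} x eq v∈S = begin
    x S                                    ≈⟨ alt-involutive k (x S) ⟨
    alt K k (alt K k (x S))                ≡⟨ cong (λ S → alt K k (alt K k (x S))) (p-y∪⁅y⁆≡p v∈S) ⟨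
    alt K k (alt K k (x ((S - v) ∪ ⁅ v ⁆)))  ≡⟨ cong (alt K k) (∂ₚ-out x (x∉p-x S v)) ⟨
    alt K k (∂ₚ v x (S - v))               ≈⟨ alt-cong k (eq (S - v)) ⟩
    alt K k 0#                             ≈⟨ alt-0 k ⟩
    0#                                     ∎
    where
    open ≈-Reasoning
    k = sign (S - v) v

  -- The chain `v ∗ z`, with the sign that makes `∂ₚ v` undo it on sets without `v`.
  cone : Fin n → Coefficients n → Coefficients n
  cone v z S = if Vec.lookup S v then alt K (sign S v) (z (S - v)) else 0#

  cone-out : ∀ (z : Coefficients n) → v ∉ S → cone v z S ≡ 0#
  cone-out {v = v} {S} z v∉S with Vec.lookup S v in eq
  ... | true = ⊥-elim (v∉S (Vecₚ.lookup⇒[]= v S eq))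
  ... | false = refl

  cone-0 : ∀ (z : Coefficients n) v S → (v ∈ S → z (S - v) ≈ 0#) → cone v z S ≈ 0#
  cone-0 z v S eq with Vec.lookup S v in l
  ... | true = ≈-trans (alt-cong (sign S v) (eq (Vecₚ.lookup⇒[]= v S l))) (alt-0 (sign S v))
  ... | false = ≈-refl

  ∂ₚ-cone : ∀ (z : Coefficients n) → v ∉ T → ∂ₚ v (cone v z) T ≈ z T
  ∂ₚ-cone {v = v} {T} z v∉T = begin
    ∂ₚ v (cone v z) T
      ≡⟨ ∂ₚ-out (cone v z) v∉T ⟩
    alt K (sign T v) (cone v z (T ∪ ⁅ v ⁆))
      ≡⟨ cong (λ b → alt K (sign T v) (if b then alt K (sign (T ∪ ⁅ v ⁆) v) (z ((T ∪ ⁅ v ⁆) - v)) else 0#))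
              (Vecₚ.[]=⇒lookup (y∈p∪⁅y⁆ {p = T})) ⟩
    alt K (sign T v) (alt K (sign (T ∪ ⁅ v ⁆) v) (z ((T ∪ ⁅ v ⁆) - v)))
      ≡⟨ ≡.cong₂ (λ k S → alt K (sign T v) (alt K k (z S))) (sign-above T (ℕₚ.<-irrefl refl)) (p∪⁅y⁆-y≡p v∉T) ⟩
    alt K (sign T v) (alt K (sign T v) (z T))
      ≈⟨ alt-involutive (sign T v) (z T) ⟩
    z T ∎
    where open ≈-Reasoning

  -- For `T` without `v`, only the insertion of `v` reaches the support of `w`.
  ∂-supported : ∀ (w : Coefficients n) → (∀ {S} → v ∉ S → w S ≈ 0#) → v ∉ T → ∂ K w T ≈ ∂ₚ v w T
  ∂-supported {v = v} {T} w supp v∉T = ≈-trans (≈-reflexive (∂≡sum w T))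
    (sum-single (λ u → ∂ₚ u w T) v λ u u≢v →
    ∂ₚ-0 w u T (supp λ v∈ → v∉T (x∈p∪⁅y⁆∧x≢y⇒x∈p T v∈ (u≢v ∘ ≡.sym))))

  ∂-cone : ∀ (z : Coefficients n) → v ∉ T → ∂ K (cone v z) T ≈ z T
  ∂-cone z v∉T = ≈-trans (∂-supported (cone _ z) (λ v∉S → ≈-reflexive (cone-out z v∉S)) v∉T) (∂ₚ-cone z v∉T)

  -- By `∂-supported` the boundary off `v` is `∂ₚ v w`, which determines `w` up to sign.
  supported-cycle≈0 : ∀ (w : Coefficients n) → (∀ {S} → v ∉ S → w S ≈ 0#) → (∀ T → ∂ K w T ≈ 0#) → ∀ S → w S ≈ 0#
  supported-cycle≈0 {v = v} w supp cycle S with v ∈? S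
  ... | no v∉S = supp v∉S
  ... | yes v∈S = ∂ₚ≈0⇒≈0 w zero-part v∈S
    where
    zero-part : ∀ T → ∂ₚ v w T ≈ 0#
    zero-part T with v ∈? T
    ... | yes v∈T = ≈-reflexive (∂ₚ-in w v∈T)
    ... | no v∉T = ≈-trans (≈-sym (∂-supported w supp v∉T)) (cycle T)

  -- Vanishing of homology from the link `L` and the deletion `D` of a vertex.

  module _ {Δ L D : Complex n} {v : Fin n} {k : ℕ}
    (link⁺ : ∀ {S} → L S → v ∉ S × Δ (S ∪ ⁅ v ⁆))
    (link⁻ : ∀ {S} → v ∉ S → Δ (S ∪ ⁅ v ⁆) → L S)
    (L⊆D : ∀ {S} → L S → D S)
    (D⊆Δ : ∀ {S} → D S → Δ S)
    (Δ⊆D : ∀ {S} → Δ S → v ∉ S → D S)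
    (acyclic-L : ∀ k′ → k ≡ suc k′ → ReducedHomologyVanishes K L k′)
    (acyclic-D : ReducedHomologyVanishes K D k) where

    private
      fill-link : ∀ x → Chain K Δ k x → (∀ T → ∂ K x T ≈ 0#) →
                  ∃[ z ] (Chain K L k z × (∀ T → ∂ₚ v x T ≈ ∂ K z T))
      fill-link x chain cycle = go k refl
        where
        go : ∀ j → k ≡ j → ∃[ z ] (Chain K L k z × (∀ T → ∂ₚ v x T ≈ ∂ K z T))
        -- In degree 0 chains live on the empty set, so the part at `v` is zero.
        go zero refl = (λ _ → 0#) , (λ _ _ → ≈-refl) , λ T →
          ≈-trans (part≈0 T) (≈-sym (∂-0 (λ _ → 0#) T λ _ → ≈-refl))
          where
          part≈0 : ∀ T → ∂ₚ v x T ≈ 0#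
          part≈0 T with v ∈? T
          ... | yes v∈T = ≈-reflexive (∂ₚ-in x v∈T)
          ... | no v∉T = ∂ₚ-0 x v T (chain _ λ { (_ , card) → ℕₚ.1+n≢0 (trans (≡.sym (∣p∪⁅y⁆∣ v∉T)) card) })
        -- The part of a cycle at `v` is again a cycle, since `∂` and `∂ₚ v` anticommute.
        go (suc k′) refl = acyclic-L k′ refl (∂ₚ v x) chain′
          λ T → ≈-trans (∂-∂ₚ x v T) (≈-trans (-‿cong (∂ₚ-0 (∂ K x) v T (cycle (T ∪ ⁅ v ⁆)))) ⊖0≈0)
          where
          chain′ : Chain K L k′ (∂ₚ v x)
          chain′ T ¬LT with v ∈? T
          ... | yes v∈T = ≈-reflexive (∂ₚ-in x v∈T)
          ... | no v∉T = ∂ₚ-0 x v T (chain _ λ { (ΔT , card) →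
            ¬LT (link⁻ v∉T ΔT , ℕₚ.suc-injective (trans (≡.sym (∣p∪⁅y⁆∣ v∉T)) card)) })

    -- With z filling the v-part of x in the link, x + ∂ (v ∗ z) is a cycle of the deletion.
    acyclic-step : ReducedHomologyVanishes K Δ k
    acyclic-step x chain cycle with fill-link x chain cycle
    ... | z , chain-z , fills with acyclic-D x′ chain-x′ cycle-x′
      where
      w x′ : Coefficients n
      w = cone v z
      x′ S = x S ⊹ ∂ K w S
      z-off : ∀ {S} → v ∈ S → z S ≈ 0#
      z-off v∈S = chain-z _ λ { (LS , _) → proj₁ (link⁺ LS) v∈S }
      ∂ₚ-w : ∀ T → ∂ₚ v w T ≈ z T
      ∂ₚ-w T with v ∈? T
      ... | yes v∈T = ≈-trans (≈-reflexive (∂ₚ-in w v∈T)) (≈-sym (z-off v∈T))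
      ... | no v∉T = ∂ₚ-cone z v∉T
      no-v : ∀ T → ∂ₚ v x′ T ≈ 0#
      no-v T = begin
        ∂ₚ v x′ T                        ≈⟨ ∂ₚ-⊹ x (∂ K w) v T ⟩
        ∂ₚ v x T ⊹ ∂ₚ v (∂ K w) T        ≈⟨ +-cong (fills T) (≈-sym (⊖-involutive _)) ⟩
        ∂ K z T ⊹ ⊖ (⊖ ∂ₚ v (∂ K w) T)   ≈⟨ +-congˡ (-‿cong (∂-∂ₚ w v T)) ⟨
        ∂ K z T ⊹ ⊖ ∂ K (∂ₚ v w) T       ≈⟨ +-congˡ (-‿cong (∂-cong (∂ₚ v w) z T λ u → ∂ₚ-w _)) ⟩
        ∂ K z T ⊹ ⊖ ∂ K z T              ≈⟨ -‿inverseʳ _ ⟩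
        0#                               ∎
        where open ≈-Reasoning
      cycle-x′ : ∀ T → ∂ K x′ T ≈ 0#
      cycle-x′ T = ≈-trans (∂-⊹ x (∂ K w) T) (≈-trans (+-cong (cycle T) (∂∂≈0 w T)) (+-identityˡ _))
      chain-x′ : Chain K D k x′
      chain-x′ S ¬DS with v ∈? S
      ... | yes v∈S = ∂ₚ≈0⇒≈0 x′ no-v v∈S
      ... | no v∉S = ≈-trans (+-cong (chain S λ { (ΔS , card) → ¬DS (Δ⊆D ΔS v∉S , card) })
        (≈-trans (∂-cone z v∉S) (chain-z S λ { (LS , card) → ¬DS (L⊆D LS , card) }))) (+-identityˡ _)
    -- From `x + ∂ (v ∗ z) = ∂ y′` the filling of `x` is `y′ - v ∗ z`.
    ... | y′ , chain-y′ , fills′ = (λ S → y′ S ⊹ ⊖ cone v z S) , chain-y , λ T → ≈-sym (begin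
      ∂ K (λ S → y′ S ⊹ ⊖ cone v z S) T        ≈⟨ ∂-⊹ y′ (λ S → ⊖ cone v z S) T ⟩
      ∂ K y′ T ⊹ ∂ K (λ S → ⊖ cone v z S) T    ≈⟨ +-cong (≈-sym (fills′ T)) (∂-⊖ (cone v z) T) ⟩
      (x T ⊹ ∂ K (cone v z) T) ⊹ ⊖ ∂ K (cone v z) T  ≈⟨ +-assoc _ _ _ ⟩
      x T ⊹ (∂ K (cone v z) T ⊹ ⊖ ∂ K (cone v z) T)  ≈⟨ +-congˡ (-‿inverseʳ _) ⟩
      x T ⊹ 0#                                 ≈⟨ +-identityʳ _ ⟩
      x T                                      ∎)
      where
      open ≈-Reasoning
      chain-y : Chain K Δ (suc k) (λ S → y′ S ⊹ ⊖ cone v z S)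
      chain-y S ¬ΔS = ≈-trans (+-cong
        (chain-y′ S λ { (DS , card) → ¬ΔS (D⊆Δ DS , card) })
        (≈-trans (-‿cong (cone-0 z v S λ v∈S → chain-z (S - v) λ { (LS , card) →
          ¬ΔS ( subst Δ (p-y∪⁅y⁆≡p v∈S) (proj₂ (link⁺ LS))
              , trans (∣p∣≡1+∣p-y∣ v∈S) (cong suc card)) })) ⊖0≈0)) (+-identityˡ _)

  void-acyclic : ∀ {Δ : Complex n} {k} → (∀ S → ¬ Δ S) → ReducedHomologyVanishes K Δ k
  void-acyclic none x chain _ = (λ _ → 0#) , (λ _ _ → ≈-refl) , λ T →
    ≈-trans (chain T (none T ∘ proj₁)) (≈-sym (∂-0 (λ _ → 0#) T λ _ → ≈-refl))

  -- Cone off from `v`: the cycle `x - ∂ (v ∗ x)` vanishes on sets without `v`, hence everywhere.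
  simplex-acyclic : ∀ {Δ : Complex n} {U k v} → v ∈ U → (∀ S → Δ S ⇔ S ⊆ U) → ReducedHomologyVanishes K Δ k
  simplex-acyclic {Δ = Δ} {U} {k} {v} v∈U eq x chain cycle = cone v x , chain-w , fills
    where
    chain-w : Chain K Δ (suc k) (cone v x)
    chain-w S ¬ΔS = cone-0 x v S λ v∈S → chain (S - v) λ { (ΔS-v , card) →
      ¬ΔS ( from (eq S) (∪⁅⁆-⊆ (to (eq _) ΔS-v) v∈U ∘ p⊆p-y∪⁅y⁆ S v)
          , trans (∣p∣≡1+∣p-y∣ v∈S) (cong suc card)) }
    difference : Coefficients _
    difference S = x S ⊹ ⊖ ∂ K (cone v x) S
    difference≈0 : ∀ S → difference S ≈ 0#
    difference≈0 = supported-cycle≈0 difference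
      (λ {S} v∉S → ≈-trans (+-congˡ (-‿cong (∂-cone x v∉S))) (-‿inverseʳ (x S)))
      λ T → ≈-trans (∂-⊹ x (λ S → ⊖ ∂ K (cone v x) S) T) (≈-trans (+-cong (cycle T)
        (≈-trans (∂-⊖ (∂ K (cone v x)) T) (≈-trans (-‿cong (∂∂≈0 (cone v x) T)) ⊖0≈0))) (+-identityˡ _))
    fills : ∀ T → x T ≈ ∂ K (cone v x) T
    fills T = begin
      x T                                    ≈⟨ +-identityʳ _ ⟨
      x T ⊹ 0#                               ≈⟨ +-congˡ (-‿inverseˡ _) ⟨
      x T ⊹ (⊖ ∂w ⊹ ∂w)                      ≈⟨ +-assoc _ _ _ ⟨
      difference T ⊹ ∂w                      ≈⟨ +-congʳ (difference≈0 T) ⟩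
      0# ⊹ ∂w                                ≈⟨ +-identityˡ _ ⟩
      ∂w                                     ∎
      where
      open ≈-Reasoning
      ∂w = ∂ K (cone v x) T

  -- Facets have `∣ U ∣` minus `d` elements, so the bound selects the degrees below the top. A split
  -- lowers `∣ U ∣` by one; the deletion of the clutter keeps the rank but is used in degree
  -- `k - 1`, the contraction lowers the rank.
  VS-acyclic : ∀ {U : Subset n} {d C Δ k} → VertexSplittable U d C →
    (∀ F → Δ F ⇔ ComplementComplex U C F) → k + d < ∣ U ∣ → ReducedHomologyVanishes K Δ k
  VS-acyclic {U = U} {Δ = Δ} (rank0 (yes C⊥) _) eq k< with nonempty? U
  -- The bound excludes an empty `U`, whose only face is empty and has nonzero reduced homology.
  ... | no e = ⊥-elim (ℕₚ.m<n⇒n≢0 k< (Empty⇒∣p∣≡0 e))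
  ... | yes (v , v∈U) = simplex-acyclic v∈U λ F → mk⇔ (face F)
    λ F⊆U → from (eq F) (F⊆U , ⊥ , C⊥ , disjoint λ _ → ∉⊥)
    where
    face : ∀ F → Δ F → F ⊆ U
    face F ΔF = proj₁ (to (eq F) ΔF)
  VS-acyclic {C = C} (rank0 (no ¬C⊥) only) eq _ = void-acyclic λ S ΔS →
    let _ , W , CW , _ = to (eq S) ΔS in ¬C⊥ (subst C (only W CW) CW)
  VS-acyclic (empty _ none) eq _ = void-acyclic λ S ΔS →
    let _ , W , CW , _ = to (eq S) ΔS in none W CW
  VS-acyclic {U = U} {suc d} {C} {Δ} {k} (split v v∈U exch vsD vsC) eq k< = acyclic-step {Δ = Δ}
    {ComplementComplex (U - v) (deletion C v)} {ComplementComplex (U - v) (contraction C v)}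
    (λ { c@(F⊆ , _) → let v∉S = x∉p-x U v ∘ F⊆ in v∉S , from (eq _) (from (complex-deletion v∈U v∉S) c) })
    (λ v∉S ΔS → to (complex-deletion v∈U v∉S) (to (eq _) ΔS))
    (λ { (S⊆ , W , (CW , v∉W) , dis) →
         complex-exchange exch (x∈p-y⇒x∈p U ∘ S⊆ , W , CW , dis) (x∉p-x U v ∘ S⊆) })
    (λ DS → from (eq _) (proj₁ (complex-contraction⁻ v∈U DS)))
    (λ ΔS v∉S → complex-exchange exch (to (eq _) ΔS) v∉S)
    (λ { k′ refl → VS-acyclic vsD (λ _ → mk⇔ id id)
         (subst (_≤ ∣ U - v ∣) (cong suc (≡.sym (ℕₚ.+-suc k′ d))) bound) })
    (VS-acyclic vsC (λ _ → mk⇔ id id) bound)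
    where
    bound : k + d < ∣ U - v ∣
    bound = ℕₚ.≤-pred (≡.subst₂ _<_ (ℕₚ.+-suc k d) (∣p∣≡1+∣p-y∣ v∈U) k<)

  -- The link of `F` is the complex of the circuits inside `∁ F`. A link face `H` with `k < ∣ H ∣`
  -- and a circuit missed by `H ∪ F` are disjoint in `∁ F`, which gives the bound of `VS-acyclic`.
  VS⇒CohenMacaulay : ∀ {d} {C : Clutter n} → VertexSplittable ⊤ d C → CohenMacaulay K (Γ C)
  VS⇒CohenMacaulay {d = d} {C} vs F _ k (H , (H#F , W , CW , HF#W) , k<) =
    VS-acyclic (VS-restrict vs (∁ F)) eq
      (ℕₚ.<-≤-trans (ℕₚ.+-monoˡ-< d k<) (subst (_≤ ∣ ∁ F ∣) size (p⊆q⇒∣p∣≤∣q∣ H∪W⊆)))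
    where
    eq : ∀ S → lkF (Γ C) F S ⇔ ComplementComplex (∁ F) (λ W → C W × W ⊆ ∁ F) S
    eq S = mk⇔
      (λ { (S#F , W , CW , SF#W) → disjoint⇒⊆∁ S#F , W
         , (CW , λ x∈W → x∉p⇒x∈∁p λ x∈F → disjoint⁻ SF#W (x∈q⇒x∈p∪q x∈F) x∈W)
         , disjoint (disjoint⁻ SF#W ∘ x∈p⇒x∈p∪q) })
      (λ { (S⊆ , W , (CW , W⊆) , S#W) → ⊆∁⇒disjoint S⊆ , W , CW
         , disjoint (λ x∈ x∈W → Sum.[ (λ x∈S → disjoint⁻ S#W x∈S x∈W) , x∈∁p⇒x∉p (W⊆ x∈W) ]′
                                      (x∈p∪q⁻ S F x∈)) })
    H∪W⊆ : H ∪ W ⊆ ∁ F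
    H∪W⊆ = ∪-⊆ (disjoint⇒⊆∁ H#F) λ x∈W → x∉p⇒x∈∁p λ x∈F → disjoint⁻ HF#W (x∈q⇒x∈p∪q x∈F) x∈W
    size : ∣ H ∪ W ∣ ≡ ∣ H ∣ + d
    size = trans (∣p∪q∣≡∣p∣+∣q∣ H W (disjoint (disjoint⁻ HF#W ∘ x∈p⇒x∈p∪q)))
                 (cong (∣ H ∣ +_) (proj₁ (VS-bounded vs CW)))

  -- A disconnected link has nonzero homology.

  δ : Subset n → Coefficients n
  δ R S = if ⌊ S ≟ₛ R ⌋ then 1# else 0#

  δ-≡ : ∀ {R S : Subset n} → S ≡ R → δ R S ≡ 1#
  δ-≡ {R = R} {S} eq with S ≟ₛ R
  ... | yes _ = refl
  ... | no ≢R = ⊥-elim (≢R eq)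

  δ-≢ : ∀ {R S : Subset n} → S ≢ R → δ R S ≡ 0#
  δ-≢ {R = R} {S} ≢R with S ≟ₛ R
  ... | yes eq = ⊥-elim (≢R eq)
  ... | no _ = refl

  -- The chain complex is augmented: the boundary of a vertex is the empty face with coefficient 1.
  ∂-δ : ∀ (a : Fin n) T → ∂ K (δ ⁅ a ⁆) T ≈ δ ⊥ T
  ∂-δ a T = ≈-trans (≈-reflexive (∂≡sum (δ ⁅ a ⁆) T))
    (≈-trans (sum-single (λ u → ∂ₚ u (δ ⁅ a ⁆) T) a λ u u≢a → ∂ₚ-0 (δ ⁅ a ⁆) u T (≈-reflexive (δ-≢ λ eq →
       u≢a (x∈⁅y⁆⇒x≡y a (subst (u ∈_) eq (y∈p∪⁅y⁆ {p = T})))))) (main (T ≟ₛ ⊥) (a ∈? T)))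
    where
    main : Dec (T ≡ ⊥) → Dec (a ∈ T) → ∂ₚ a (δ ⁅ a ⁆) T ≈ δ ⊥ T
    main (yes refl) _ = ≈-reflexive (trans (∂ₚ-out {T = ⊥} (δ ⁅ a ⁆) ∉⊥) (trans
      (≡.cong₂ (alt K) (Empty⇒∣p∣≡0 {p = ⊥ ∩ below K a} λ { (_ , x∈) → ∉⊥ (proj₁ (x∈p∩q⁻ ⊥ (below K a) x∈)) })
                       (δ-≡ (∪-identityˡ ⁅ a ⁆)))
      (≡.sym (δ-≡ {R = ⊥} refl))))
    main (no T≢⊥) (yes a∈T) = ≈-reflexive (trans (∂ₚ-in (δ ⁅ a ⁆) a∈T) (≡.sym (δ-≢ T≢⊥)))
    main (no T≢⊥) (no a∉T) = ≈-trans (∂ₚ-0 (δ ⁅ a ⁆) a T (≈-reflexive (δ-≢ λ eq →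
      T≢⊥ (∪⁅⁆-injective a∉T ∉⊥ (trans eq (≡.sym (∪-identityˡ ⁅ a ⁆))))))) (≈-reflexive (≡.sym (δ-≢ T≢⊥)))

  -- The link of ∁ (A ∪ B) is disconnected: a filling of the cycle a − b would restrict on A to a
  -- filling of a, contradicting ∂∂ = 0.
  CohenMacaulay⇒¬Gap : ∀ {C : Clutter n} {d e A B} → CohenMacaulay K (Γ C) →
                       ∣ A ∣ ≡ 2 + d → ∣ B ∣ ≡ 2 + e → ¬ Gap C A B
  CohenMacaulay⇒¬Gap {n} {C = C} {A = A} {B} cm cardA cardB g = 0≉1 (begin
    0#                         ≈⟨ ∂∂≈0 yA ⊥ ⟨
    ∂ K (∂ K yA) ⊥             ≈⟨ ∂-cong (∂ K yA) (δ ⁅ a ⁆) ⊥ (λ v → subst (λ S → ∂ K yA S ≈ δ ⁅ a ⁆ S)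
                                    (≡.sym (∪-identityˡ ⁅ v ⁆)) (∂yA v)) ⟩
    ∂ K (δ ⁅ a ⁆) ⊥            ≈⟨ ∂-δ a ⊥ ⟩
    δ ⊥ ⊥                      ≡⟨ δ-≡ {R = ⊥} refl ⟩
    1#                         ∎)
    where
    open ≈-Reasoning
    open Gap g
    F = ∁ (A ∪ B)
    L = lkF (Γ C) F
    a = proj₁ (∣p∣≡1+k⇒Nonempty cardA)
    b = proj₁ (∣p∣≡1+k⇒Nonempty cardB)
    a∈A : a ∈ A
    a∈A = proj₂ (∣p∣≡1+k⇒Nonempty cardA)
    b∈B : b ∈ B
    b∈B = proj₂ (∣p∣≡1+k⇒Nonempty cardB)
    face⁺ : ∀ {S} → S ⊆ A ⊎ S ⊆ B → L S
    face⁺ (inj₁ S⊆A) = ⊆∁⇒disjoint (λ x∈S → x∉p⇒x∈∁p λ x∈F → x∈∁p⇒x∉p x∈F (x∈p⇒x∈p∪q (S⊆A x∈S)))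
      , B , B∈C , disjoint λ x∈ x∈B → Sum.[ (λ x∈S → disjoint⁻ apart (S⊆A x∈S) x∈B)
                                         , (λ x∈F → x∈∁p⇒x∉p x∈F (x∈q⇒x∈p∪q x∈B)) ]′ (x∈p∪q⁻ _ F x∈)
    face⁺ (inj₂ S⊆B) = ⊆∁⇒disjoint (λ x∈S → x∉p⇒x∈∁p λ x∈F → x∈∁p⇒x∉p x∈F (x∈q⇒x∈p∪q (S⊆B x∈S)))
      , A , A∈C , disjoint λ x∈ x∈A → Sum.[ (λ x∈S → disjoint⁻ apart x∈A (S⊆B x∈S))
                                         , (λ x∈F → x∈∁p⇒x∉p x∈F (x∈p⇒x∈p∪q x∈A)) ]′ (x∈p∪q⁻ _ F x∈)
    face⁻ : ∀ {S} → L S → S ⊆ A ⊎ S ⊆ B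
    face⁻ {S} (S#F , ΓSF) with to (∁∪-faces g (S ∪ F) x∈q⇒x∈p∪q) ΓSF
    ... | inj₁ ⊆∁A = inj₂ λ x∈S → Sum.[ (λ x∈A → ⊥-elim (x∈∁p⇒x∉p (⊆∁A (x∈p⇒x∈p∪q x∈S)) x∈A)) , id ]′
                                        (x∈p∪q⁻ A B (x∉∁p⇒x∈p (disjoint⁻ S#F x∈S)))
    ... | inj₂ ⊆∁B = inj₁ λ x∈S → Sum.[ id , (λ x∈B → ⊥-elim (x∈∁p⇒x∉p (⊆∁B (x∈p⇒x∈p∪q x∈S)) x∈B)) ]′
                                        (x∈p∪q⁻ A B (x∉∁p⇒x∈p (disjoint⁻ S#F x∈S)))
    ⁅⁆⊆ : ∀ {p : Subset n} {v} → v ∈ p → ⁅ v ⁆ ⊆ p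
    ⁅⁆⊆ v∈p x∈ = subst (_∈ _) (≡.sym (x∈⁅y⁆⇒x≡y _ x∈)) v∈p
    x : Coefficients n
    x S = δ ⁅ a ⁆ S ⊹ ⊖ δ ⁅ b ⁆ S
    chain-x : Chain K L 1 x
    chain-x S ¬LS = ≈-trans (+-cong
      (≈-reflexive (δ-≢ λ { refl → ¬LS (face⁺ (inj₁ (⁅⁆⊆ a∈A)) , ∣⁅x⁆∣≡1 a) }))
      (≈-trans (-‿cong (≈-reflexive (δ-≢ λ { refl → ¬LS (face⁺ (inj₂ (⁅⁆⊆ b∈B)) , ∣⁅x⁆∣≡1 b) }))) ⊖0≈0))
      (+-identityˡ _)
    cycle-x : ∀ T → ∂ K x T ≈ 0#
    cycle-x T = begin
      ∂ K x T                                       ≈⟨ ∂-⊹ (δ ⁅ a ⁆) (λ S → ⊖ δ ⁅ b ⁆ S) T ⟩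
      ∂ K (δ ⁅ a ⁆) T ⊹ ∂ K (λ S → ⊖ δ ⁅ b ⁆ S) T   ≈⟨ +-cong (∂-δ a T) (≈-trans (∂-⊖ (δ ⁅ b ⁆) T) (-‿cong (∂-δ b T))) ⟩
      δ ⊥ T ⊹ ⊖ δ ⊥ T                               ≈⟨ -‿inverseʳ _ ⟩
      0#                                            ∎
    -- Degree 1 means chains on vertices; `A` is a face of the link with more than one vertex, so
    -- the Cohen-Macaulay condition applies.
    filling = cm F (A , A∈C , ⊆∁⇒disjoint (p⊆q⇒∁p⊇∁q x∈p⇒x∈p∪q)) 1
      (A , face⁺ (inj₁ id) , subst (1 <_) (≡.sym cardA) (s≤s (s≤s z≤n))) x chain-x cycle-x
    y yA : Coefficients n
    y = proj₁ filling
    yA S = if ⌊ S ⊆? A ⌋ then y S else 0#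
    yA-out : ∀ {S} → ¬ (S ⊆ A) → yA S ≡ 0#
    yA-out {S} S⊈A with S ⊆? A
    ... | yes S⊆A = ⊥-elim (S⊈A S⊆A)
    ... | no _ = refl
    -- A face of the link that meets `A` lies in `A`, so cutting `y` down to subsets of `A` changes
    -- nothing there.
    yA≈y : ∀ {S v} → v ∈ A → v ∈ S → yA S ≈ y S
    yA≈y {S} v∈A v∈S with S ⊆? A
    ... | yes _ = ≈-refl
    ... | no S⊈A = ≈-sym (proj₁ (proj₂ filling) S λ { (LS , _) → Sum.[ S⊈A ,
      (λ S⊆B → disjoint⁻ apart v∈A (S⊆B v∈S)) ]′ (face⁻ LS) })
    ∂yA : ∀ v → ∂ K yA ⁅ v ⁆ ≈ δ ⁅ a ⁆ ⁅ v ⁆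
    ∂yA v with v ∈? A
    ... | yes v∈A = begin
      ∂ K yA ⁅ v ⁆                    ≈⟨ ∂-cong yA y ⁅ v ⁆ (λ u → yA≈y v∈A (x∈p⇒x∈p∪q (x∈⁅x⁆ v))) ⟩
      ∂ K y ⁅ v ⁆                     ≈⟨ proj₂ (proj₂ filling) ⁅ v ⁆ ⟨
      δ ⁅ a ⁆ ⁅ v ⁆ ⊹ ⊖ δ ⁅ b ⁆ ⁅ v ⁆  ≡⟨ cong (λ c → δ ⁅ a ⁆ ⁅ v ⁆ ⊹ ⊖ c) (δ-≢ λ eq → disjoint⁻ apart v∈A
                                          (⁅⁆⊆ b∈B (subst (v ∈_) eq (x∈⁅x⁆ v)))) ⟩
      δ ⁅ a ⁆ ⁅ v ⁆ ⊹ ⊖ 0#            ≈⟨ +-congˡ ⊖0≈0 ⟩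
      δ ⁅ a ⁆ ⁅ v ⁆ ⊹ 0#              ≈⟨ +-identityʳ _ ⟩
      δ ⁅ a ⁆ ⁅ v ⁆                   ∎
    ... | no v∉A = ≈-trans
      (∂-0 yA ⁅ v ⁆ λ u → ≈-reflexive (yA-out λ ⊆A → v∉A (⊆A (x∈p⇒x∈p∪q (x∈⁅x⁆ v)))))
      (≈-reflexive (≡.sym (δ-≢ λ eq → v∉A (⁅⁆⊆ a∈A (subst (v ∈_) eq (x∈⁅x⁆ v))))))

theorem4p7 : ∀ {c ℓ : Level} (K : Field c ℓ) {n : ℕ} (G : Graph n) → IsCograph G →
    (r : ℕ) → 2 ≤ r →
    (VertexDecomposable (Σr r G) ⇔ Shellable (Σr r G))
    × (Shellable (Σr r G) ⇔ CohenMacaulay K (Σr r G))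
    × (CohenMacaulay K (Σr r G) ⇔ GapFree r G)
    × (GapFree r G ⇔ CoChordal r (Con r G))
theorem4p7 K {n} G cograph (suc (suc d)) (s≤s (s≤s _)) =
    mk⇔ (gapFree⇒shellable ∘ vd⇒gapFree) (gapFree⇒vd ∘ shellable⇒gapFree)
  , mk⇔ (gapFree⇒cm ∘ shellable⇒gapFree) (gapFree⇒shellable ∘ cm⇒gapFree)
  , mk⇔ cm⇒gapFree gapFree⇒cm
  , mk⇔ gapFree⇒coChordal coChordal⇒gapFree
  where
  r = suc (suc d)
  splittable : GapFree r G → VertexSplittable ⊤ r (Con r G)
  splittable = cograph-VS cograph
  gapFree⇒vd : GapFree r G → VertexDecomposable (Σr r G)
  gapFree⇒vd gf = VS⇒VertexDecomposable (splittable gf) λ F → mk⇔ (inside F) proj₂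
    where
    inside : ∀ F → Σr r G F → ComplementComplex ⊤ (Con r G) F
    inside F face = ⊆⊤ , face
  gapFree⇒shellable : GapFree r G → Shellable (Σr r G)
  gapFree⇒shellable = VS⇒Shellable ∘ splittable
  gapFree⇒cm : GapFree r G → CohenMacaulay K (Σr r G)
  gapFree⇒cm = VS⇒CohenMacaulay K ∘ splittable
  gapFree⇒coChordal : GapFree r G → CoChordal r (Con r G)
  gapFree⇒coChordal = VS⇒CoChordal ∘ splittable
  gap⇒split : ∀ {A B} → Gap (Con r G) A B → SplitLink (Σr r G) (∁ (A ∪ B)) (∁ A) (∁ B)
  gap⇒split g = Gap⇒SplitLink (proj₁ (Gap.A∈C g)) (proj₁ (Gap.B∈C g)) g
  vd⇒gapFree : VertexDecomposable (Σr r G) → GapFree r G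
  vd⇒gapFree vd = ¬Gap⇒GapFree {G = G} λ A B g → VertexDecomposable⇒¬SplitLink vd (gap⇒split g)
  shellable⇒gapFree : Shellable (Σr r G) → GapFree r G
  shellable⇒gapFree sh = ¬Gap⇒GapFree {G = G} λ A B → Shellable⇒¬Gap proj₁ sh
  cm⇒gapFree : CohenMacaulay K (Σr r G) → GapFree r G
  cm⇒gapFree cm = ¬Gap⇒GapFree {G = G} λ A B g →
    CohenMacaulay⇒¬Gap K cm (proj₁ (Gap.A∈C g)) (proj₁ (Gap.B∈C g)) g
  coChordal⇒gapFree : CoChordal r (Con r G) → GapFree r G
  coChordal⇒gapFree ch = ¬Gap⇒GapFree {G = G} λ A B → CoChordal⇒¬Gap proj₁ ch
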